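{- If $G$ is a finite strongly chordal graph, then $G$ admits an MAT-labeling.
   Context: A graph is chordal if it has no induced cycle of length greater than three; it is strongly chordal if it is chordal and has no induced $n$-sun for any $n\ge3$, where the $n$-sun has vertices $u_1,\dots,u_n,w_1,\dots,w_n$ and edges $\{u_i,u_j\}$ ($1\le i<j\le n$), $\{w_i,u_i\},\{w_i,u_{i+1}\}$ (indices mod $n$). For a simple graph $G$ and $\lambda:E_G\to\mathbb{Z}_{>0}$ put $\pi_k=\lambda^{ -1}(k)$, $E_k=\pi_1\sqcup\dots\sqcup\pi_k$, $E_0=\varnothing$; $\operatorname{cl}(F)$ is the set of edges whose endvertices are joined by a path of edges in $F$; $\lambda$ is an MAT-labeling if for all $k\ge1$: (ML1) $\pi_k$ is a forest; (ML2) $\operatorname{cl}(\pi_k)\cap E_{k-1}=\varnothing$; (ML3) each $\{u,u'\}\in\pi_k$ has exactly $k-1$ vertices $w$ with $\{u,w\},\{u',w\}\in E_{k-1}$. -}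

module Defs where

open import Data.Nat using (ℕ; zero; suc; _+_; _∸_; _≤_; _≡ᵇ_; _≤ᵇ_)
open import Data.Fin using (Fin; zero; suc; toℕ; inject₁; fromℕ; splitAt; _≟_)
open import Data.Bool using (Bool; true; false; _∧_; _∨_; not; if_then_else_)
open import Data.Sum using (_⊎_; inj₁; inj₂)
open import Data.Product using (Σ; _×_; _,_)
open import Relation.Nullary using (¬_)
open import Relation.Nullary.Decidable using (⌊_⌋)
open import Relation.Binary.PropositionalEquality using (_≡_)
open import Relation.Binary.Construct.Closure.ReflexiveTransitive using (Star)
open import Function.Definitions using (Injective)

record Graph (n : ℕ) : Set where
  field
    adj     : Fin n → Fin n → Bool
    adj-sym : ∀ u v → adj u v ≡ adj v u
    adj-irr : ∀ u → adj u u ≡ false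
open Graph public

Induced : ∀ {k n} → (Fin k → Fin k → Bool) → Graph n → Set
Induced {k} {n} H G =
  Σ (Fin k → Fin n) λ f → Injective _≡_ _≡_ f × (∀ i j → adj G (f i) (f j) ≡ H i j)

cycAdjℕ : ℕ → ℕ → ℕ → Bool
cycAdjℕ m a b = (suc a ≡ᵇ b) ∨ (suc b ≡ᵇ a)
              ∨ ((a ≡ᵇ 0) ∧ (suc b ≡ᵇ m)) ∨ ((b ≡ᵇ 0) ∧ (suc a ≡ᵇ m))

Cyc : (m : ℕ) → Fin m → Fin m → Bool
Cyc m i j = cycAdjℕ m (toℕ i) (toℕ j)

-- n-sun on Fin (m + m): inj₁ i ↦ u_i, inj₂ i ↦ w_i.
-- u_i ~ u_j (i ≠ j);  w_i ~ u_i, w_i ~ u_{i+1 mod m};  no w–w edges.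
wuAdj : (m : ℕ) → Fin m → Fin m → Bool
wuAdj m i j = (toℕ j ≡ᵇ toℕ i) ∨ (toℕ j ≡ᵇ suc (toℕ i))
            ∨ ((toℕ j ≡ᵇ 0) ∧ (suc (toℕ i) ≡ᵇ m))

sunAdj : (m : ℕ) → Fin m ⊎ Fin m → Fin m ⊎ Fin m → Bool
sunAdj m (inj₁ i) (inj₁ j) = not ⌊ i ≟ j ⌋
sunAdj m (inj₁ i) (inj₂ j) = wuAdj m j i
sunAdj m (inj₂ i) (inj₁ j) = wuAdj m i j
sunAdj m (inj₂ i) (inj₂ j) = false

Sun : (m : ℕ) → Fin (m + m) → Fin (m + m) → Bool
Sun m i j = sunAdj m (splitAt m i) (splitAt m j)

Chordal : ∀ {n} → Graph n → Set
Chordal G = ∀ m → ¬ Induced (Cyc (4 + m)) G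

StronglyChordal : ∀ {n} → Graph n → Set
StronglyChordal G = Chordal G × (∀ m → ¬ Induced (Sun (3 + m)) G)

EdgeSet : ℕ → Set₁
EdgeSet n = Fin n → Fin n → Set

Cycle : ∀ {n} → EdgeSet n → Set
Cycle {n} F = Σ ℕ λ m → Σ (Fin (3 + m) → Fin n) λ c →
  Injective _≡_ _≡_ c
  × (∀ (i : Fin (2 + m)) → F (c (inject₁ i)) (c (suc i)))
  × F (c (fromℕ (2 + m))) (c zero)

Forest : ∀ {n} → EdgeSet n → Set
Forest F = ¬ Cycle F

-- A labeling λ : E_G → ℤ_{>0}, represented as a symmetric function on vertex
-- pairs which is positive on the edges (values on non-edges are irrelevant).
record Labeling {n} (G : Graph n) : Set where
  field
    lab     : Fin n → Fin n → ℕ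
    lab-sym : ∀ u v → lab u v ≡ lab v u
    lab-pos : ∀ u v → adj G u v ≡ true → 1 ≤ lab u v
open Labeling public

module _ {n} {G : Graph n} (L : Labeling G) where
  π : ℕ → EdgeSet n
  π k u v = (adj G u v ≡ true) × (lab L u v ≡ k)

  -- E_k = π_1 ⊔ … ⊔ π_k  (as a Boolean test)
  inE : ℕ → Fin n → Fin n → Bool
  inE k u v = adj G u v ∧ (lab L u v ≤ᵇ k)

  E : ℕ → EdgeSet n
  E k u v = inE k u v ≡ true

countB : ∀ {n} → (Fin n → Bool) → ℕ
countB {zero}  f = 0
countB {suc n} f = (if f zero then 1 else 0) + countB (λ i → f (suc i))

cl : ∀ {n} → Graph n → EdgeSet n → EdgeSet n
cl G F u v = (adj G u v ≡ true) × Star F u v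

record IsMATLabeling {n} {G : Graph n} (L : Labeling G) : Set where
  field
    ML1 : ∀ k → 1 ≤ k → Forest (π L k)
    ML2 : ∀ k → 1 ≤ k → ∀ u v → ¬ (cl G (π L k) u v × E L (k ∸ 1) u v)
    ML3 : ∀ k → 1 ≤ k → ∀ u u' → π L k u u' →
            countB (λ w → inE L (k ∸ 1) u w ∧ inE L (k ∸ 1) u' w) ≡ k ∸ 1

HasMATLabeling : ∀ {n} → Graph n → Set
HasMATLabeling G = Σ (Labeling G) IsMATLabeling

{-# OPTIONS --safe #-}
-- The hypergraph of maximal cliques of a strongly chordal graph has no special cycle of length ≥ 3: in a
-- shortest one the vertices either form an induced cycle or lie in one clique, and then suitable
-- vertices of the hyperedges complete them to an induced sun.  A hypergraph without special cycles
-- has a nest point (the hyperedges through it form a chain), also after restriction to any vertex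
-- set, so the vertices can be eliminated through nest points.
-- Adding a nest point x back, we maintain that every hyperedge carries a "good" labeling: its
-- largest label d − 1 sits on a single edge ab, and it stays good after deleting a or b.  A good
-- set properly inside a good set K misses a or b, so the chain of hyperedges through x refines to
-- a flag of good sets.  Labeling the edges at x by the position in this flag preserves both the
-- MAT property and the goodness of all hyperedges.
module Submission where

open import Data.Bool using (Bool; true; false; _∧_; _∨_; if_then_else_)
import Data.Bool.Properties as Bool
open import Data.Bool.Properties using (∧-comm; ¬-not; T-≡)
open import Data.Empty using (⊥; ⊥-elim)
open import Data.Fin using (Fin; zero; suc; toℕ; inject₁; fromℕ; splitAt; join)
import Data.Fin.Properties as Fin
open import Data.Fin.Relation.Unary.Top using (view; ‵fromℕ; ‵inject₁)
open import Data.Fin.Subset using (Subset; _∈_; _∉_; _⊆_; _⊂_; _∩_; _∪_; _-_; ⁅_⁆; ∣_∣) renaming (⊤ to full)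
open import Data.Fin.Subset.Induction using (⊂-wellFounded; Acc; acc)
open import Data.Fin.Subset.Properties
open import Data.Nat using (ℕ; zero; suc; _+_; _∸_; _≤_; _<_; z≤n; s≤s; _≤ᵇ_; _≡ᵇ_)
open import Data.Nat.Induction using (<-rec)
open import Data.Nat.Properties
open import Data.Product using (Σ; ∃; _×_; _,_; proj₁; proj₂)
open import Data.Sum using (_⊎_; inj₁; inj₂)
open import Data.Vec using ([]; _∷_; tabulate; lookup)
open import Data.Vec.Properties using ([]=⇒lookup; lookup⇒[]=; lookup∘tabulate; ≡-dec)
open import Function using (Equivalence)
open import Relation.Binary.Construct.Closure.ReflexiveTransitive using (Star; ε; _◅_; reverse)
import Relation.Binary.Construct.Closure.ReflexiveTransitive as Star
open import Relation.Binary.Definitions using (tri<; tri≈; tri>)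
open import Relation.Binary.PropositionalEquality
open import Relation.Nullary using (¬_; Dec; yes; no; does)
open import Relation.Nullary.Decidable using (dec-true; dec-false; ¬?; _×-dec_; _→-dec_; _⊎-dec_; decidable-stable)
open import Relation.Unary using (Decidable)

open import Defs

-- The neighbours of a new vertex x form a clique and are numbered 1, 2, ..., so (ML3) for the edge
-- of label k at x asks that the k - 1 earlier neighbours be joined to its end by old edges of label
-- below k. A flag of good sets provides this: a good set of k vertices has all its labels below k.
-- An MAT-labeling alone is too weak to carry through the induction, since the neighbourhoods of
-- vertices still to be added are traces of hyperedges that must already be good. A hyperedge
-- through x stays good only if its trace is one of the sets of the flag; traces lie on a common
-- flag only when they form a chain, and this is why x has to be a nest point. The flag can be
-- steered through a chain because a good proper subset of a good set of d vertices has only labels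
-- below d - 1 and so cannot contain both ends of the top edge.

private
  variable
    n : ℕ

-- Finite sets

select : {P : Fin n → Set} → Decidable P → Subset n
select P? = tabulate λ x → does (P? x)

∈select⁺ : {P : Fin n → Set} (P? : Decidable P) {x : Fin n} → P x → x ∈ select P?
∈select⁺ P? {x} px = lookup⇒[]= x _ (trans (lookup∘tabulate _ x) (dec-true (P? x) px))

∈select⁻ : {P : Fin n → Set} (P? : Decidable P) {x : Fin n} → x ∈ select P? → P x
∈select⁻ P? {x} x∈ with P? x | trans (sym (lookup∘tabulate (λ y → does (P? y)) x)) ([]=⇒lookup x∈)
... | yes px | _  = px
... | no  _  | ()

x∉p-x : {p : Subset n} {x : Fin n} → x ∉ p - x
x∉p-x {p = _ ∷ _} {zero} ()
x∉p-x {p = _ ∷ _} {suc x} x∈ = x∉p-x (drop-there x∈)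

x∈p-y⇒x∈p : {p : Subset n} {x y : Fin n} → x ∈ p - y → x ∈ p
x∈p-y⇒x∈p {p = p} {y = y} = p─q⊆p p ⁅ y ⁆

x∈p-y⇒x≢y : {p : Subset n} {x y : Fin n} → x ∈ p - y → x ≢ y
x∈p-y⇒x≢y {p = p} x∈ refl = x∉p-x {p = p} x∈

⊆-remove : {p q : Subset n} {x : Fin n} → p ⊆ q → x ∉ p → p ⊆ q - x
⊆-remove p⊆q x∉p y∈p = x∈p∧x≢y⇒x∈p-y (p⊆q y∈p) λ { refl → x∉p y∈p }

∣p-x∣ : (p : Subset n) {x : Fin n} → x ∈ p → ∣ p ∣ ≡ suc ∣ p - x ∣
∣p-x∣ (true ∷ p) {zero} _ = cong (λ q → suc ∣ q ∣) (sym (p─⊥≡p p))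
∣p-x∣ (true  ∷ p) {suc x} x∈ = cong suc (∣p-x∣ p (drop-there x∈))
∣p-x∣ (false ∷ p) {suc x} x∈ = ∣p-x∣ p (drop-there x∈)

-- Turns a choice of largest cardinality into an exchange: a competitor that gains an element must
-- lose another.
card-exchange : {p q : Subset n} {x : Fin n} → ∣ p ∣ ≤ ∣ q ∣ → x ∈ p → x ∉ q →
                ∃ λ y → y ∈ q × y ∉ p
card-exchange {p = p} {q} ∣p∣≤∣q∣ x∈p x∉q with Fin.any? (λ y → (y ∈? q) ×-dec ¬? (y ∈? p))
... | yes y∈q∖p = y∈q∖p
... | no  ¬y    = ⊥-elim (<⇒≱ (p⊂q⇒∣p∣<∣q∣ (q⊆p , _ , x∈p , x∉q)) ∣p∣≤∣q∣)
  where
  q⊆p : q ⊆ p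
  q⊆p {y} y∈q = decidable-stable (y ∈? p) λ y∉p → ¬y (y , y∈q , y∉p)

⊈⇒∃ : {p q : Subset n} → ¬ p ⊆ q → ∃ λ x → x ∈ p × x ∉ q
⊈⇒∃ {p = p} {q} p⊈q with Fin.any? (λ x → (x ∈? p) ×-dec ¬? (x ∈? q))
... | yes x∈p∖q = x∈p∖q
... | no  ¬x    = ⊥-elim (p⊈q λ {x} x∈p → decidable-stable (x ∈? q) λ x∉q → ¬x (x , x∈p , x∉q))

Searchable : Set → Set₁
Searchable A = {P : A → Set} → Decidable P → Dec (∃ P)

module _ {A : Set} (search : Searchable A) where

  forall? : {P : A → Set} → Decidable P → Dec (∀ a → P a)
  forall? P? with search (λ a → ¬? (P? a))
  ... | yes (a , ¬pa) = no λ p → ¬pa (p a)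
  ... | no  ¬∃        = yes λ a → decidable-stable (P? a) λ ¬pa → ¬∃ (a , ¬pa)

  argmax : {P : A → Set} → Decidable P → (μ : A → ℕ) (N : ℕ) → (∀ a → μ a ≤ N) →
           ∃ P → ∃ λ a → P a × (∀ b → P b → μ b ≤ μ a)
  argmax {P} P? μ N μ≤N (a , pa) = climb N a pa (m≤n+m N (μ a))
    where
    -- `k` bounds the room left for growth below `N`; each strict improvement uses up one unit.
    climb : ∀ k a → P a → N ≤ μ a + k → ∃ λ a → P a × (∀ b → P b → μ b ≤ μ a)
    climb zero a pa N≤ = a , pa , λ b _ → ≤-trans (μ≤N b) (subst (N ≤_) (+-identityʳ _) N≤)
    climb (suc k) a pa N≤ with search (λ b → P? b ×-dec (suc (μ a) ≤? μ b))
    ... | yes (b , pb , a<b) =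
      climb k b pb (≤-trans (subst (N ≤_) (+-suc (μ a) k) N≤) (+-monoˡ-≤ k a<b))
    ... | no ¬b = a , pa , λ b pb → ≮⇒≥ λ a<b → ¬b (b , pb , a<b)

-- A single instance of excluded middle is irrefutable, and a finite type needs only finitely many.
¬¬-decide : (P : Fin n → Set) → ¬ ¬ (Decidable P)
¬¬-decide {zero}  P ¬d = ¬d λ ()
¬¬-decide {suc n} P ¬d =
  ¬¬-decide (λ i → P (suc i)) λ d →
  let rest = λ p₀ → ¬d λ { zero → p₀ ; (suc i) → d i }
  in rest (no λ p → rest (yes p))

-- Nest points of totally balanced hypergraphs

-- A cycle of length 1 + K in the hypergraph 𝓗, cut open at the hyperedge e.
record SpecialCycle (𝓗 : Subset n → Set) (K : ℕ) : Set where
  field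
    y     : ℕ → Fin n
    c     : ℕ → Subset n
    e     : Subset n
    c∈𝓗   : ∀ {i} → i < K → 𝓗 (c i)
    e∈𝓗   : 𝓗 e
    left  : ∀ {i} → i < K → y i ∈ c i
    right : ∀ {i} → i < K → y (suc i) ∈ c i
    only  : ∀ {i j} → i < K → j ≤ K → y j ∈ c i → j ≡ i ⊎ j ≡ suc i
    first : y 0 ∈ e
    last  : y K ∈ e
    ends  : ∀ {j} → j ≤ K → y j ∈ e → j ≡ 0 ⊎ j ≡ K

-- `K` does not count the closing hyperedge, so `2 ≤ K` means length at least three.
TotallyBalanced : (Subset n → Set) → Set
TotallyBalanced 𝓗 = ∀ K → 2 ≤ K → ¬ SpecialCycle 𝓗 K

ComparableOn : Subset n → Subset n → Subset n → Set
ComparableOn V f g = (V ∩ f ⊆ g) ⊎ (V ∩ g ⊆ f)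

NestPoint : (Subset n → Set) → Subset n → Fin n → Set
NestPoint 𝓗 V x = ∀ f g → 𝓗 f → 𝓗 g → x ∈ f → x ∈ g → ComparableOn V f g

cons : {A : Set} → A → (ℕ → A) → ℕ → A
cons a s zero    = a
cons a s (suc i) = s i

module _ {𝓗 : Subset n → Set} (𝓗? : Decidable 𝓗) (tb : TotallyBalanced 𝓗) where

  nestPoint? : ∀ V → Decidable (NestPoint 𝓗 V)
  nestPoint? V x =
    forall? anySubset? λ f → forall? anySubset? λ g →
      𝓗? f →-dec 𝓗? g →-dec (x ∈? f) →-dec (x ∈? g) →-dec
      ((V ∩ f ⊆? g) ⊎-dec (V ∩ g ⊆? f))

  Proper : Subset n → Subset n → Set
  Proper V f = 𝓗 f × ¬ V ⊆ f

  module Component (V e f : Subset n) (e∈𝓗 : 𝓗 e) (f-proper : Proper V f) where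

    -- The component of `f` once `e` is removed from `V`: consecutive hyperedges share a vertex of
    -- `V` outside `e`. Counting the steps makes shortest walks available.
    data Walk : ℕ → Subset n → Set where
      start : Walk 0 f
      step  : ∀ {k g h z} → Walk k g → z ∈ V → z ∉ e → z ∈ g → z ∈ h → Proper V h → Walk (suc k) h

    walk-proper : ∀ {k g} → Walk k g → Proper V g
    walk-proper start = f-proper
    walk-proper (step _ _ _ _ _ h-proper) = h-proper

    Meets : Subset n → Set
    Meets g = ∃ λ z → z ∈ V × z ∉ e × z ∈ g

    -- The tail of a shortest walk, preceded by i earlier steps, towards a hyperedge
    -- containing b; `far` expresses that no shortcuts exist.
    record Tail (a b : Fin n) (i : ℕ) (g : Subset n) : Set where
      field
        L      : ℕ
        y      : ℕ → Fin n
        c      : ℕ → Subset n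
        head   : c 0 ≡ g
        c∈𝓗    : ∀ {j} → j ≤ L → Proper V (c j)
        far    : ∀ {j} → j ≤ L → ∀ {m} → Walk m (c j) → i + j ≤ m
        left   : ∀ {j} → j ≤ L → y j ∈ c j
        right  : ∀ {j} → j < L → y j ∈ c (suc j)
        only   : ∀ {i j} → i ≤ L → j ≤ L → y j ∈ c i → i ≡ j ⊎ i ≡ suc j
        links  : ∀ {j} → j < L → y j ∈ V × y j ∉ e
        end    : y L ≡ b
        avoids : ∀ {j} → j < L → a ∉ c (suc j)
        -- Otherwise closing at `L = 0` would give a cycle of only the two hyperedges `g` and `e`.
        final  : L ≡ 0 → a ∉ g

    module _ {a b : Fin n} (a∈f : a ∈ f) (a∈e : a ∈ e) (b∈e : b ∈ e) where

      -- With `a` put in front, `e` closes the tail: the inner links avoid `e`, so `e` meets the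
      -- vertices only in `a` and `b`, and no hyperedge after the first contains `a`.
      close : ∀ {i g} → Tail a b i g → a ∈ g → ⊥
      close {i} {g} t a∈g = tb (suc L) (s≤s (n≢0⇒n>0 λ L≡0 → final L≡0 a∈g)) record
        { y = cons a y ; c = c ; e = e
        ; c∈𝓗 = λ { (s≤s j≤L) → proj₁ (c∈𝓗 j≤L) }
        ; e∈𝓗 = e∈𝓗
        ; left = λ { {zero} _ → subst (a ∈_) (sym head) a∈g ; {suc j} (s≤s j<L) → right j<L }
        ; right = λ { (s≤s j≤L) → left j≤L }
        ; only = λ { {zero} {zero} _ _ _ → inj₁ refl
                   ; {suc i} {zero} (s≤s i<L) _ a∈ → ⊥-elim (avoids i<L a∈)
                   ; {i} {suc j} (s≤s i≤L) (s≤s j≤L) y∈ → swap (only i≤L j≤L y∈) }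
        ; first = a∈e
        ; last = subst (_∈ e) (sym end) b∈e
        ; ends = λ { {zero} _ _ → inj₁ refl
                   ; {suc j} (s≤s j≤L) y∈e → inj₂ (cong suc (only-last j≤L y∈e)) } }
        where
        open Tail t
        swap : ∀ {i j} → i ≡ j ⊎ i ≡ suc j → suc j ≡ i ⊎ suc j ≡ suc i
        swap (inj₁ p) = inj₂ (cong suc (sym p))
        swap (inj₂ p) = inj₁ (sym p)
        only-last : ∀ {j} → j ≤ L → y j ∈ e → j ≡ L
        only-last j≤L y∈e with m≤n⇒m<n∨m≡n j≤L
        ... | inj₁ j<L = ⊥-elim (proj₂ (links j<L) y∈e)
        ... | inj₂ j≡L = j≡L

      extend : ∀ {i g h z} → (w : Walk i g) → z ∈ V → z ∉ e → z ∈ g → z ∈ h → a ∉ h → b ∉ g →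
               Tail a b (suc i) h → Tail a b i g
      extend {i} {g} {h} {z} w z∈V z∉e z∈g z∈h a∉h b∉g t = record
        { L = suc L ; y = cons z y ; c = cons g c ; head = refl
        ; c∈𝓗 = λ { {zero} _ → walk-proper w ; {suc j} (s≤s j≤L) → c∈𝓗 j≤L }
        -- A walk to `g` continues through `z` to `h`, which takes at least `i + 1` steps.
        ; far = λ { {zero} _ {m} w′ → subst (_≤ m) (sym (+-identityʳ i))
                      (≤-pred (far₀ (step w′ z∈V z∉e z∈g z∈h (h-proper))))
                  ; {suc j} (s≤s j≤L) {m} w′ → subst (_≤ m) (sym (+-suc i j)) (far j≤L w′) }
        ; left = λ { {zero} _ → z∈g ; {suc j} (s≤s j≤L) → left j≤L }
        ; right = λ { {zero} _ → subst (z ∈_) (sym head) z∈h ; {suc j} (s≤s j<L) → right j<L }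
        ; only = λ { {zero} {zero} _ _ _ → inj₁ refl
                   ; {zero} {suc j} _ (s≤s j≤L) y∈g → ⊥-elim (y∉g j≤L y∈g)
                   ; {suc zero} {zero} _ _ _ → inj₂ refl
                   ; {suc (suc k)} {zero} (s≤s k<L) _ z∈c → ⊥-elim (no-shortcut k<L w z∈V z∉e z∈g z∈c)
                   ; {suc k} {suc j} (s≤s k≤L) (s≤s j≤L) y∈ → shift (only k≤L j≤L y∈) }
        ; links = λ { {zero} _ → z∈V , z∉e ; {suc j} (s≤s j<L) → links j<L }
        ; end = end
        ; avoids = λ { {zero} _ → subst (a ∉_) (sym head) a∉h ; {suc j} (s≤s j<L) → avoids j<L }
        ; final = λ () }
        where
        open Tail t
        h-proper : Proper V h
        h-proper = subst (Proper V) head (c∈𝓗 z≤n)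
        far₀ : ∀ {m} → Walk m h → suc i ≤ m
        far₀ {m} w′ = subst (_≤ m) (+-identityʳ (suc i)) (far z≤n (subst (Walk m) (sym head) w′))
        -- The shared vertex would reach a hyperedge beyond `h` in `i + 1` steps, fewer than `far`
        -- permits.
        no-shortcut : ∀ {k g z} → k < L → Walk i g → z ∈ V → z ∉ e → z ∈ g → z ∈ c (suc k) → ⊥
        no-shortcut {k} k<L w z∈V z∉e z∈g z∈c =
          m+1+n≰m (suc i) (far k<L (step w z∈V z∉e z∈g z∈c (c∈𝓗 k<L)))
        y∉g : ∀ {j} → j ≤ L → y j ∉ g
        y∉g {j} j≤L y∈g with m≤n⇒m<n∨m≡n j≤L
        ... | inj₁ j<L = no-shortcut j<L w (proj₁ (links j<L)) (proj₂ (links j<L)) y∈g (right j<L)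
        ... | inj₂ refl = b∉g (subst (_∈ g) end y∈g)
        shift : ∀ {k j} → k ≡ j ⊎ k ≡ suc j → suc k ≡ suc j ⊎ suc k ≡ suc (suc j)
        shift (inj₁ p) = inj₁ (cong suc p)
        shift (inj₂ p) = inj₂ (cong suc p)

      -- The walk is traced back until `a` appears, which happens at `f` at the latest.
      descend : ∀ {i g} → Walk i g → (∀ {j h} → j < i → Walk j h → b ∉ h) → Tail a b i g → ⊥
      descend start _ t = close t a∈f
      descend {suc i} {g} w@(step v z∈V z∉e z∈h z∈g _) b∉ t with a ∈? g
      ... | yes a∈g = close t a∈g
      ... | no  a∉g = descend v (λ j<i → b∉ (m<n⇒m<1+n j<i))
                        (extend v z∈V z∉e z∈h z∈g a∉g (b∉ ≤-refl v) t)

    module _ (f-meets : Meets f)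
             (f-max : ∀ g → Proper V g → Meets g → ∣ (e ∩ V) ∩ g ∣ ≤ ∣ (e ∩ V) ∩ f ∣) where

      walk-meets : ∀ {k g} → Walk k g → Meets g
      walk-meets start = f-meets
      walk-meets (step _ z∈V z∉e _ z∈h _) = _ , z∈V , z∉e , z∈h

      -- A shortest walk violating this is closed by e to a special cycle.
      attachment : ∀ k {g b} → Walk k g → b ∈ e → b ∈ V → b ∈ g → b ∈ f
      attachment = <-rec _ λ k rec {g} {b} w b∈e b∈V b∈g → decidable-stable (b ∈? f) λ b∉f →
        let b∈ : b ∈ (e ∩ V) ∩ g
            b∈ = x∈p∩q⁺ (x∈p∩q⁺ (b∈e , b∈V) , b∈g)
            -- The trace of `f` on `e ∩ V` is largest, so `g`, which gains `b`, loses some `a`.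
            -- These two become the vertices of the cycle on `e`.
            a , a∈ , a∉ = card-exchange (f-max g (walk-proper w) (walk-meets w)) b∈
                            λ b∈′ → b∉f (proj₂ (x∈p∩q⁻ _ _ b∈′))
            a∈eV , a∈f = x∈p∩q⁻ (e ∩ V) f a∈
            b∉ : ∀ {j h} → j < k → Walk j h → b ∉ h
            b∉ j<k v b∈h = b∉f (rec j<k v b∈e b∈V b∈h)
        in descend {a = a} {b} a∈f (proj₁ (x∈p∩q⁻ e V a∈eV)) b∈e w b∉ record
          { L = 0 ; y = λ _ → b ; c = λ _ → g ; head = refl
          ; c∈𝓗 = λ _ → walk-proper w
          ; far = λ { z≤n v → subst (_≤ _) (sym (+-identityʳ k)) (≮⇒≥ λ m<k → b∉ m<k v b∈g) }
          ; left = λ _ → b∈g ; right = λ ()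
          ; only = λ { z≤n z≤n _ → inj₁ refl }
          ; links = λ () ; end = refl ; avoids = λ ()
          ; final = λ _ a∈g → a∉ (x∈p∩q⁺ (a∈eV , a∈g)) }

  -- The condition `x ∉ e` drives the induction: on passing to a smaller set `W`, only for vertices
  -- outside `e` is it known that the proper hyperedges through them keep their whole trace.
  NestPointOutside : Subset n → Subset n → Set
  NestPointOutside V e = ∃ λ x → x ∈ V × x ∉ e × NestPoint 𝓗 V x

  nestPointOutside? : ∀ V e → Dec (NestPointOutside V e)
  nestPointOutside? V e = Fin.any? λ x → (x ∈? V) ×-dec ¬? (x ∈? e) ×-dec nestPoint? V x

  proper? : ∀ V → Decidable (Proper V)
  proper? V f = 𝓗? f ×-dec ¬? (V ⊆? f)

  comparable-⊇ˡ : ∀ {V f g : Subset n} → V ⊆ f → ComparableOn V f g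
  comparable-⊇ˡ {V} {f} {g} V⊆f = inj₂ λ x∈ → V⊆f (proj₁ (x∈p∩q⁻ V g x∈))

  comparable-⊇ʳ : ∀ {V f g : Subset n} → V ⊆ g → ComparableOn V f g
  comparable-⊇ʳ {V} {f} {g} V⊆g = inj₁ λ x∈ → V⊆g (proj₁ (x∈p∩q⁻ V f x∈))

  comparable-proper : ∀ {V f g : Subset n} → 𝓗 f → 𝓗 g →
                      (Proper V f → Proper V g → ComparableOn V f g) → ComparableOn V f g
  comparable-proper {V} {f} {g} f∈𝓗 g∈𝓗 cmp with V ⊆? f | V ⊆? g
  ... | yes V⊆f | _       = comparable-⊇ˡ V⊆f
  ... | no  _   | yes V⊆g = comparable-⊇ʳ V⊆g
  ... | no  V⊈f | no  V⊈g = cmp (f∈𝓗 , V⊈f) (g∈𝓗 , V⊈g)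

  -- If no proper hyperedge leaves `e` inside `V`, any vertex outside `e` works. Otherwise `f`
  -- leaves `e` and has the largest trace on it, and `W` consists of the component of `f` outside
  -- `e` together with `e ∩ f`. A proper hyperedge through a component vertex stays in `W`: outside
  -- `e` by reachability, inside `e` by `attachment`. So a nest point of `W` outside `e` is one of
  -- `V`.
  nest-point-outside-maximal :
    ∀ V e → Proper V e →
    (∀ f → Proper V f → V ∩ e ⊆ f → V ∩ f ⊆ e) →
    (∀ W → W ⊂ V → ∀ e → Proper W e → NestPointOutside W e) →
    NestPointOutside V e
  nest-point-outside-maximal V e (e∈𝓗 , V⊈e) e-max rec
    with anySubset? (λ f → proper? V f ×-dec Fin.any? (λ z → (z ∈? V) ×-dec ¬? (z ∈? e) ×-dec (z ∈? f)))
  ... | no ¬f =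
    let x , x∈V , x∉e = ⊈⇒∃ V⊈e
    in x , x∈V , x∉e , λ f g f∈𝓗 g∈𝓗 x∈f _ →
         comparable-proper f∈𝓗 g∈𝓗 λ f-proper _ → ⊥-elim (¬f (f , f-proper , x , x∈V , x∉e , x∈f))
  ... | yes f₀ with argmax anySubset?
                      (λ f → proper? V f ×-dec Fin.any? (λ z → (z ∈? V) ×-dec ¬? (z ∈? e) ×-dec (z ∈? f)))
                      (λ f → ∣ (e ∩ V) ∩ f ∣) n (λ f → ∣p∣≤n ((e ∩ V) ∩ f)) f₀
  ... | f , (f-proper , f-meets@(z , z∈V , z∉e , z∈f)) , f-max =
    -- The goal is decidable, so the reachability predicate InA may be assumed decidable.
    decidable-stable (nestPointOutside? V e) λ ¬nest → ¬¬-decide InA λ InA? → ¬nest (found InA?)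
    where
    open Component V e f e∈𝓗 f-proper

    InA : Fin n → Set
    InA x = x ∉ e × ∃ λ k → ∃ λ g → Walk k g × x ∈ g

    found : Decidable InA → NestPointOutside V e
    found InA? = x , x∈V , x∉e , λ f₁ f₂ f₁∈𝓗 f₂∈𝓗 x∈f₁ x∈f₂ →
      comparable-proper f₁∈𝓗 f₂∈𝓗 λ f₁-proper f₂-proper →
        transfer x∈f₁ x∈f₂ f₁-proper f₂-proper (nest f₁ f₂ f₁∈𝓗 f₂∈𝓗 x∈f₁ x∈f₂)
      where
      InW : Fin n → Set
      InW x = x ∈ V × (InA x ⊎ (x ∈ e × x ∈ f))
      InW? : Decidable InW
      InW? x = (x ∈? V) ×-dec (InA? x ⊎-dec ((x ∈? e) ×-dec (x ∈? f)))
      W : Subset n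
      W = select InW?
      W⊂V : W ⊂ V
      W⊂V =
        -- If `f` contained `V ∩ e`, maximality of `e` would put `z` into `e`. The vertex `b` found
        -- here is the one that `W` loses.
        let b , b∈V∩e , b∉f = ⊈⇒∃ {p = V ∩ e} {f} λ e⊆f → z∉e (e-max f f-proper e⊆f (x∈p∩q⁺ (z∈V , z∈f)))
            b∈V , b∈e = x∈p∩q⁻ V e b∈V∩e
        in (λ x∈W → proj₁ (∈select⁻ InW? x∈W)) , b , b∈V ,
           λ b∈W → contra b∈e b∉f (proj₂ (∈select⁻ InW? b∈W))
        where
        contra : ∀ {b} → b ∈ e → b ∉ f → InA b ⊎ (b ∈ e × b ∈ f) → ⊥
        contra b∈e _ (inj₁ (b∉e , _)) = b∉e b∈e
        contra _ b∉f (inj₂ (_ , b∈f)) = b∉f b∈f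
      inner : NestPointOutside W e
      inner = rec W W⊂V e (e∈𝓗 , λ W⊆e → z∉e (W⊆e (∈select⁺ InW? (z∈V , inj₁ (z∉e , _ , _ , start , z∈f)))))
      x : Fin n
      x = proj₁ inner
      x∉e : x ∉ e
      x∉e = proj₁ (proj₂ (proj₂ inner))
      nest : NestPoint 𝓗 W x
      nest = proj₂ (proj₂ (proj₂ inner))
      x∈W : InW x
      x∈W = ∈select⁻ InW? (proj₁ (proj₂ inner))
      x∈V : x ∈ V
      x∈V = proj₁ x∈W
      x∈A : InA x
      x∈A with proj₂ x∈W
      ... | inj₁ x∈A = x∈A
      ... | inj₂ (x∈e , _) = ⊥-elim (x∉e x∈e)
      V∩h⊆W : ∀ {h} → x ∈ h → Proper V h → ∀ {v} → v ∈ V → v ∈ h → v ∈ W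
      V∩h⊆W {h} x∈h h-proper {v} v∈V v∈h = ∈select⁺ InW? (v∈V , side)
        where
        walk : ∃ λ k → Walk k h
        walk = let _ , k , _ , w , x∈g = x∈A in suc k , step w x∈V x∉e x∈g x∈h h-proper
        side : InA v ⊎ (v ∈ e × v ∈ f)
        side with v ∈? e
        ... | yes v∈e = inj₂ (v∈e , attachment f-meets (λ g gp gm → f-max g (gp , gm)) _ (proj₂ walk) v∈e v∈V v∈h)
        ... | no  v∉e = inj₁ (v∉e , _ , _ , proj₂ walk , v∈h)
      transfer : ∀ {f₁ f₂} → x ∈ f₁ → x ∈ f₂ → Proper V f₁ → Proper V f₂ →
                 ComparableOn W f₁ f₂ → ComparableOn V f₁ f₂
      transfer {f₁} x∈f₁ _ f₁-proper _ (inj₁ ⊆₂) = inj₁ λ v∈ →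
        let v∈V , v∈f₁ = x∈p∩q⁻ V f₁ v∈ in ⊆₂ (x∈p∩q⁺ (V∩h⊆W x∈f₁ f₁-proper v∈V v∈f₁ , v∈f₁))
      transfer {f₂ = f₂} _ x∈f₂ _ f₂-proper (inj₂ ⊆₁) = inj₂ λ v∈ →
        let v∈V , v∈f₂ = x∈p∩q⁻ V f₂ v∈ in ⊆₁ (x∈p∩q⁺ (V∩h⊆W x∈f₂ f₂-proper v∈V v∈f₂ , v∈f₂))

  -- Enlarging `e` to a proper hyperedge with maximal trace only sharpens the demand on `x`.
  nest-point-outside : ∀ V → Acc _⊂_ V → ∀ e → Proper V e → NestPointOutside V e
  nest-point-outside V (acc rec) e e-proper
    with argmax anySubset? (λ f → proper? V f ×-dec (V ∩ e ⊆? f)) (λ f → ∣ V ∩ f ∣) n (λ f → ∣p∣≤n (V ∩ f))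
           (e , e-proper , p∩q⊆q V e)
  ... | f , (f-proper , e⊆f) , f-max =
    let x , x∈V , x∉f , nest = nest-point-outside-maximal V f f-proper maximal
                                 λ W W⊂V → nest-point-outside W (rec W⊂V)
    in x , x∈V , (λ x∈e → x∉f (e⊆f (x∈p∩q⁺ (x∈V , x∈e)))) , nest
    where
    maximal : ∀ g → Proper V g → V ∩ f ⊆ g → V ∩ g ⊆ f
    maximal g g-proper f⊆g {x} x∈Vg = decidable-stable (x ∈? f) λ x∉f →
      let a , a∈ , a∉ = card-exchange (f-max g (g-proper , λ v∈ → f⊆g (x∈p∩q⁺ (proj₁ (x∈p∩q⁻ V e v∈) , e⊆f v∈))))
                          x∈Vg λ x∈Vf → x∉f (proj₂ (x∈p∩q⁻ V f x∈Vf))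
      in a∉ (x∈p∩q⁺ (proj₁ (x∈p∩q⁻ V f a∈) , f⊆g a∈))

  nest-point : ∀ V {v} → v ∈ V → ∃ λ x → x ∈ V × NestPoint 𝓗 V x
  nest-point V {v} v∈V with anySubset? (proper? V)
  ... | yes (e , e-proper) =
    let x , x∈V , _ , nest = nest-point-outside V (⊂-wellFounded V) e e-proper in x , x∈V , nest
  ... | no ¬proper = v , v∈V , λ f g f∈𝓗 g∈𝓗 _ _ →
    comparable-proper f∈𝓗 g∈𝓗 λ f-proper _ → ⊥-elim (¬proper (f , f-proper))

-- Boolean tests and adjacency

bool-ext : ∀ {b c : Bool} → (b ≡ true → c ≡ true) → (c ≡ true → b ≡ true) → b ≡ c
bool-ext {true}          b⇒c _   = sym (b⇒c refl)
bool-ext {false} {true}  _   c⇒b = c⇒b refl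
bool-ext {false} {false} _   _   = refl

∧-true⁺ : ∀ {b c : Bool} → b ≡ true → c ≡ true → b ∧ c ≡ true
∧-true⁺ refl refl = refl

∧-true⁻ : ∀ {b c : Bool} → b ∧ c ≡ true → b ≡ true × c ≡ true
∧-true⁻ {true} c≡ = refl , c≡

≤ᵇ-true⁺ : ∀ {m k} → m ≤ k → (m ≤ᵇ k) ≡ true
≤ᵇ-true⁺ m≤k = Equivalence.to T-≡ (≤⇒≤ᵇ m≤k)

≤ᵇ-true⁻ : ∀ {m k} → (m ≤ᵇ k) ≡ true → m ≤ k
≤ᵇ-true⁻ {m} eq = ≤ᵇ⇒≤ m _ (Equivalence.from T-≡ eq)

∨-true⁺ : ∀ {b c : Bool} → b ≡ true ⊎ c ≡ true → b ∨ c ≡ true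
∨-true⁺ {true}  _           = refl
∨-true⁺ {false} (inj₂ refl) = refl

∨-true⁻ : ∀ {b c : Bool} → b ∨ c ≡ true → b ≡ true ⊎ c ≡ true
∨-true⁻ {true}  _  = inj₁ refl
∨-true⁻ {false} eq = inj₂ eq

≡ᵇ-true⁺ : ∀ {a b} → a ≡ b → (a ≡ᵇ b) ≡ true
≡ᵇ-true⁺ {a} {b} eq = Equivalence.to T-≡ (≡⇒≡ᵇ a b eq)

≡ᵇ-true⁻ : ∀ {a b} → (a ≡ᵇ b) ≡ true → a ≡ b
≡ᵇ-true⁻ {a} {b} eq = ≡ᵇ⇒≡ a b (Equivalence.from T-≡ eq)

false≢true : ∀ {b : Bool} → b ≡ false → b ≡ true → ⊥
false≢true refl ()

adj-flip : ∀ (G : Graph n) {u v b} → adj G u v ≡ b → adj G v u ≡ b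
adj-flip G {u} {v} uv = trans (adj-sym G v u) uv

adj⇒≢ : ∀ (G : Graph n) {u v} → adj G u v ≡ true → u ≢ v
adj⇒≢ G {u} uu refl = false≢true (adj-irr G u) uu

-- Good sets and flags

countB-cong : {f g : Fin n → Bool} → (∀ i → f i ≡ g i) → countB f ≡ countB g
countB-cong {zero}  f≗g = refl
countB-cong {suc n} f≗g =
  cong₂ (λ b k → (if b then 1 else 0) + k) (f≗g zero) (countB-cong (λ i → f≗g (suc i)))

countB-lookup : (p : Subset n) → countB (lookup p) ≡ ∣ p ∣
countB-lookup []          = refl
countB-lookup (true  ∷ p) = cong suc (countB-lookup p)
countB-lookup (false ∷ p) = countB-lookup p

-- Serves (ML1): in a cycle of one label through a new vertex, the two neighbours found here would
-- have the same position.
cycle-neighbours : (F : EdgeSet n) {m : ℕ} (c : Fin (3 + m) → Fin n) →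
                   (∀ (i : Fin (2 + m)) → F (c (inject₁ i)) (c (suc i))) → F (c (fromℕ (2 + m))) (c zero) →
                   ∀ i → ∃ λ j → ∃ λ j′ → j ≢ j′ × F (c j) (c i) × F (c i) (c j′)
cycle-neighbours F {m} c path closing zero =
  fromℕ (2 + m) , suc zero , (λ ()) , closing , path zero
cycle-neighbours F {m} c path closing (suc i) with view i
... | ‵fromℕ = inject₁ (fromℕ (suc m)) , zero , (λ ()) , path (fromℕ (suc m)) , closing
... | ‵inject₁ i′ = inject₁ (inject₁ i′) , suc (suc i′) , apart , path (inject₁ i′) , path (suc i′)
  where
  apart : inject₁ (inject₁ i′) ≢ suc (suc i′)
  apart eq = m≢1+n+m (toℕ i′) {1}
    (trans (sym (trans (Fin.toℕ-inject₁ (inject₁ i′)) (Fin.toℕ-inject₁ i′))) (cong toℕ eq))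

module _ (lab : Fin n → Fin n → ℕ) where

  -- The clique structures on which lab restricts to an MAT-labeling of a complete graph:
  -- the largest label d − 1 occurs once, at ab, and deleting a or b leaves such a structure.
  data Good : ℕ → Subset n → Set where
    empty  : ∀ {K} → (∀ x → x ∉ K) → Good 0 K
    single : ∀ {K x} → x ∈ K → Good 0 (K - x) → Good 1 K
    pair   : ∀ {d K a b} → a ≢ b → a ∈ K → b ∈ K → lab a b ≡ suc d →
             Good (suc d) (K - a) → Good (suc d) (K - b) → Good (suc (suc d)) K

  -- A full chain of good sets, one of each size down to the empty set, stored through the vertex
  -- dropped at each step.
  data Flag : ℕ → Subset n → Set where
    []  : ∀ {K} → (∀ x → x ∉ K) → Flag 0 K
    add : ∀ {d K} y → y ∈ K → Good (suc d) K → Flag d (K - y) → Flag (suc d) K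

  Member : ∀ {d K} → Subset n → Flag d K → Set
  Member {K = K} Y ([] _)        = Y ≡ K
  Member {K = K} Y (add _ _ _ F) = Y ≡ K ⊎ Member Y F

  position : ∀ {d K} → Flag d K → Fin n → ℕ
  -- Reached only by `z` outside the set of the flag; these are not joined to the added vertex.
  position ([] _) z = 0
  position (add {d} y _ _ F) z = if does (z Fin.≟ y) then suc d else position F z

position-top : ∀ {lab : Fin n → Fin n → ℕ} {d K} y (y∈K : y ∈ K) (g : Good lab (suc d) K) (F : Flag lab d (K - y)) →
               position lab (add y y∈K g F) y ≡ suc d
position-top y y∈K g F rewrite dec-true (y Fin.≟ y) refl = refl

position-rest : ∀ {lab : Fin n → Fin n → ℕ} {d K} y (y∈K : y ∈ K) (g : Good lab (suc d) K) (F : Flag lab d (K - y)) {z} →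
                z ≢ y → position lab (add y y∈K g F) z ≡ position lab F z
position-rest y y∈K g F {z} z≢y rewrite dec-false (z Fin.≟ y) z≢y = refl

good-cong : ∀ {lab lab′ : Fin n → Fin n → ℕ} {d K} → (∀ u v → u ∈ K → v ∈ K → lab u v ≡ lab′ u v) →
            Good lab d K → Good lab′ d K
good-cong eq (empty ∉K) = empty ∉K
good-cong eq (single x∈K g) = single x∈K (good-cong (λ u v u∈ v∈ → eq u v (x∈p-y⇒x∈p u∈) (x∈p-y⇒x∈p v∈)) g)
good-cong eq (pair a≢b a∈K b∈K l g h) =
  pair a≢b a∈K b∈K (trans (sym (eq _ _ a∈K b∈K)) l)
    (good-cong (λ u v u∈ v∈ → eq u v (x∈p-y⇒x∈p u∈) (x∈p-y⇒x∈p v∈)) g)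
    (good-cong (λ u v u∈ v∈ → eq u v (x∈p-y⇒x∈p u∈) (x∈p-y⇒x∈p v∈)) h)

good-card : ∀ {lab : Fin n → Fin n → ℕ} {d K} → Good lab d K → ∣ K ∣ ≡ d
good-card {n} (empty ∉K) = trans (cong ∣_∣ (Empty-unique (λ (x , x∈K) → ∉K x x∈K))) (∣⊥∣≡0 n)
good-card {K = K} (single x∈K g) = trans (∣p-x∣ K x∈K) (cong suc (good-card g))
good-card {K = K} (pair _ a∈K _ _ g _) = trans (∣p-x∣ K a∈K) (cong suc (good-card g))

module _ {lab : Fin n → Fin n → ℕ} (lab-sym : ∀ u v → lab u v ≡ lab v u) where

  -- Unless `x` and `y` are the ends of the top edge, one of those ends can be deleted while keeping
  -- both `x` and `y`.
  good-bound : ∀ {d K} → Good lab d K → ∀ {x y} → x ∈ K → y ∈ K → x ≢ y → lab x y < d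
  good-bound (empty ∉K) x∈K _ _ = ⊥-elim (∉K _ x∈K)
  good-bound (single {x = z} z∈K (empty ∉K)) {x} {y} x∈K y∈K x≢y with x Fin.≟ z | y Fin.≟ z
  ... | yes refl | yes refl = ⊥-elim (x≢y refl)
  ... | no x≢z | _ = ⊥-elim (∉K x (x∈p∧x≢y⇒x∈p-y x∈K x≢z))
  ... | _ | no y≢z = ⊥-elim (∉K y (x∈p∧x≢y⇒x∈p-y y∈K y≢z))
  good-bound (pair {a = a} {b} a≢b a∈K b∈K l g h) {x} {y} x∈K y∈K x≢y with x Fin.≟ a | y Fin.≟ a
  ... | no x≢a | no y≢a =
    m<n⇒m<1+n (good-bound g (x∈p∧x≢y⇒x∈p-y x∈K x≢a) (x∈p∧x≢y⇒x∈p-y y∈K y≢a) x≢y)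
  ... | yes refl | yes refl = ⊥-elim (x≢y refl)
  ... | yes refl | no _ with y Fin.≟ b
  ...   | yes refl = ≤-reflexive (cong suc l)
  ...   | no y≢b   = m<n⇒m<1+n (good-bound h (x∈p∧x≢y⇒x∈p-y x∈K a≢b) (x∈p∧x≢y⇒x∈p-y y∈K y≢b) x≢y)
  good-bound (pair {a = a} {b} a≢b a∈K b∈K l g h) {x} {y} x∈K y∈K x≢y | no _ | yes refl with x Fin.≟ b
  ... | yes refl = ≤-reflexive (cong suc (trans (lab-sym x y) l))
  ... | no x≢b   = m<n⇒m<1+n (good-bound h (x∈p∧x≢y⇒x∈p-y x∈K x≢b) (x∈p∧x≢y⇒x∈p-y y∈K a≢b) x≢y)

  good-⊆-≡ : ∀ {d d′ K Y} → Good lab d K → Good lab d′ Y → Y ⊆ K → d ≤ d′ → Y ≡ K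
  good-⊆-≡ {K = K} {Y} gK gY Y⊆K d≤d′ = ⊆-antisym Y⊆K λ {x} x∈K → decidable-stable (x ∈? Y) λ x∉Y →
    let a , a∈Y , a∉K = card-exchange (subst₂ _≤_ (sym (good-card gK)) (sym (good-card gY)) d≤d′) x∈K x∉Y
    in a∉K (Y⊆K a∈Y)

  module _ {𝒞 : Subset n → Set} (𝒞? : Decidable 𝒞)
           (good : ∀ {Y} → 𝒞 Y → ∃ λ d → Good lab d Y)
           (chain : ∀ {Y Z} → 𝒞 Y → 𝒞 Z → Y ⊆ Z ⊎ Z ⊆ Y) where

    Through : ∀ {d K} → Flag lab d K → Set
    Through {K = K} F = ∀ Y → 𝒞 Y → Y ⊆ K → Member lab Y F

    through-add : ∀ {d K y} (y∈K : y ∈ K) (g : Good lab (suc d) K) (F : Flag lab d (K - y)) →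
                  Through F → (∀ Y → 𝒞 Y → Y ⊆ K → Y ≢ K → y ∉ Y) → Through (add y y∈K g F)
    through-add {K = K} _ _ _ thr y∉ Y Y∈𝒞 Y⊆K with ≡-dec Bool._≟_ Y K
    ... | yes Y≡K = inj₁ Y≡K
    ... | no  Y≢K = inj₂ (thr Y Y∈𝒞 (⊆-remove Y⊆K (y∉ Y Y∈𝒞 Y⊆K Y≢K)))

    -- A chain member containing both ends of the top edge is all of `K`. If some member `Y₀` has
    -- `a` but not `b`, then `b` is dropped: a member with `b` contains `Y₀`, hence `a` too. If
    -- there is none, every member with `a` has `b`, and `a` is dropped.
    flag-through : ∀ {d K} → Good lab d K → Σ (Flag lab d K) Through
    flag-through (empty ∉K) = [] ∉K , λ Y _ Y⊆K → ⊆-antisym Y⊆K λ x∈K → ⊥-elim (∉K _ x∈K)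
    flag-through g@(single {K = K} {x} x∈K h@(empty ∉K)) =
      add x x∈K g ([] ∉K) , through-add x∈K g ([] ∉K) (proj₂ (flag-through h)) λ Y _ Y⊆K Y≢K x∈Y →
        Y≢K (⊆-antisym Y⊆K λ {z} z∈K → K⊆ x∈Y z∈K)
      where
      K⊆ : ∀ {Y z} → x ∈ Y → z ∈ K → z ∈ Y
      K⊆ {z = z} x∈Y z∈K with z Fin.≟ x
      ... | yes refl = x∈Y
      ... | no z≢x = ⊥-elim (∉K z (x∈p∧x≢y⇒x∈p-y z∈K z≢x))
    flag-through g@(pair {d} {K} {a} {b} a≢b a∈K b∈K l ga gb)
      with anySubset? (λ Y → 𝒞? Y ×-dec (Y ⊆? K) ×-dec (a ∈? Y) ×-dec ¬? (b ∈? Y))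
    ... | yes (Y₀ , Y₀∈𝒞 , Y₀⊆K , a∈Y₀ , b∉Y₀) =
      add b b∈K g (proj₁ (flag-through gb)) , through-add b∈K g (proj₁ (flag-through gb)) (proj₂ (flag-through gb)) b∉
      where
      b∉ : ∀ Y → 𝒞 Y → Y ⊆ K → Y ≢ K → b ∉ Y
      b∉ Y Y∈𝒞 Y⊆K Y≢K b∈Y with chain Y∈𝒞 Y₀∈𝒞
      ... | inj₁ Y⊆Y₀ = b∉Y₀ (Y⊆Y₀ b∈Y)
      -- `Y` has both ends, and their label `suc d` forces it to have at least as many vertices as
      -- `K`.
      ... | inj₂ Y₀⊆Y = Y≢K (good-⊆-≡ g (proj₂ (good Y∈𝒞)) Y⊆K
                          (subst (_< proj₁ (good Y∈𝒞)) l (good-bound (proj₂ (good Y∈𝒞)) (Y₀⊆Y a∈Y₀) b∈Y a≢b)))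
    ... | no ¬Y₀ = add a a∈K g (proj₁ (flag-through ga)) , through-add a∈K g (proj₁ (flag-through ga)) (proj₂ (flag-through ga)) a∉
      where
      a∉ : ∀ Y → 𝒞 Y → Y ⊆ K → Y ≢ K → a ∉ Y
      a∉ Y Y∈𝒞 Y⊆K Y≢K a∈Y with b ∈? Y
      ... | no  b∉Y = ¬Y₀ (Y , Y∈𝒞 , Y⊆K , a∈Y , b∉Y)
      ... | yes b∈Y = Y≢K (good-⊆-≡ g (proj₂ (good Y∈𝒞)) Y⊆K
                          (subst (_< proj₁ (good Y∈𝒞)) l (good-bound (proj₂ (good Y∈𝒞)) a∈Y b∈Y a≢b)))

  position-bounds : ∀ {d K} (F : Flag lab d K) {z} → z ∈ K → 1 ≤ position lab F z × position lab F z ≤ d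
  position-bounds ([] ∉K) z∈K = ⊥-elim (∉K _ z∈K)
  position-bounds (add {d} y y∈K g F) {z} z∈K with z Fin.≟ y
  ... | yes refl = s≤s z≤n , ≤-refl
  ... | no z≢y = let l , u = position-bounds F (x∈p∧x≢y⇒x∈p-y z∈K z≢y) in l , m≤n⇒m≤1+n u

  position-injective : ∀ {d K} (F : Flag lab d K) {y z} → y ∈ K → z ∈ K →
                       position lab F y ≡ position lab F z → y ≡ z
  position-injective ([] ∉K) y∈K _ _ = ⊥-elim (∉K _ y∈K)
  position-injective (add {d} t _ _ F) {y} {z} y∈K z∈K eq with y Fin.≟ t | z Fin.≟ t
  ... | yes refl | yes refl = refl
  ... | yes refl | no z≢t = ⊥-elim (1+n≰n (subst (_≤ d) (sym eq) (proj₂ (position-bounds F (x∈p∧x≢y⇒x∈p-y z∈K z≢t)))))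
  ... | no y≢t | yes refl = ⊥-elim (1+n≰n (subst (_≤ d) eq (proj₂ (position-bounds F (x∈p∧x≢y⇒x∈p-y y∈K y≢t)))))
  ... | no y≢t | no z≢t = position-injective F (x∈p∧x≢y⇒x∈p-y y∈K y≢t) (x∈p∧x≢y⇒x∈p-y z∈K z≢t) eq

  -- The vertex dropped first has the size of the current good set as its position, and the other
  -- vertex still lies in that set.
  position-dominates : ∀ {d K} (F : Flag lab d K) {y z} → y ∈ K → z ∈ K → y ≢ z →
                       lab y z < position lab F y ⊎ lab y z < position lab F z
  position-dominates ([] ∉K) y∈K _ _ = ⊥-elim (∉K _ y∈K)
  position-dominates (add t _ g F) {y} {z} y∈K z∈K y≢z with y Fin.≟ t | z Fin.≟ t
  ... | yes _ | _     = inj₁ (good-bound g y∈K z∈K y≢z)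
  ... | no _  | yes _ = inj₂ (good-bound g y∈K z∈K y≢z)
  ... | no y≢t | no z≢t = position-dominates F (x∈p∧x≢y⇒x∈p-y y∈K y≢t) (x∈p∧x≢y⇒x∈p-y z∈K z≢t) y≢z

  -- `Y` is the set of size `k` in the flag. Its size becomes the triangle count in (ML3).
  position-prefix : ∀ {d K} (F : Flag lab d K) k → k ≤ d →
                    ∃ λ Y → ∣ Y ∣ ≡ k × (∀ {w} → w ∈ Y → w ∈ K × position lab F w ≤ k)
                                      × (∀ {w} → w ∈ K → position lab F w ≤ k → w ∈ Y)
  position-prefix {K = K} ([] ∉K) .0 z≤n =
    K , good-card {lab = lab} (empty ∉K) , (λ w∈K → w∈K , z≤n) , λ w∈K _ → w∈K
  position-prefix {K = K} F@(add {d} y y∈K g F′) k k≤1+d with m≤n⇒m<n∨m≡n k≤1+d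
  ... | inj₂ refl = K , good-card g , (λ w∈K → w∈K , proj₂ (position-bounds F w∈K)) , λ w∈K _ → w∈K
  ... | inj₁ (s≤s k≤d) with position-prefix F′ k k≤d
  ... | Y , ∣Y∣ , Y⁻ , Y⁺ = Y , ∣Y∣ , to , from
    where
    to : ∀ {w} → w ∈ Y → w ∈ K × position lab F w ≤ k
    to {w} w∈Y = let w∈ , p≤k = Y⁻ w∈Y in
      x∈p-y⇒x∈p w∈ , subst (_≤ k) (sym (position-rest y y∈K g F′ (x∈p-y⇒x≢y {p = K} w∈))) p≤k
    from : ∀ {w} → w ∈ K → position lab F w ≤ k → w ∈ Y
    from {w} w∈K p≤k with w Fin.≟ y
    ... | yes refl = ⊥-elim (1+n≰n (≤-trans p≤k k≤d))
    ... | no  w≢y = Y⁺ (x∈p∧x≢y⇒x∈p-y w∈K w≢y) p≤k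

module _ {lab lab′ : Fin n → Fin n → ℕ} {x : Fin n}
         (agree : ∀ u v → u ≢ x → v ≢ x → lab u v ≡ lab′ u v) where

  good-keep : ∀ {d K} → x ∉ K → Good lab d K → Good lab′ d K
  good-keep x∉K = good-cong λ u v u∈K v∈K →
    agree u v (λ { refl → x∉K u∈K }) (λ { refl → x∉K v∈K })

  -- The new top edge joins `x` to the first dropped vertex `y`. Deleting `x` gives back `K`;
  -- deleting `y` leaves the same situation for the rest of the flag.
  good-insert : ∀ {d K} (F : Flag lab d K) → x ∉ K → (∀ {z} → z ∈ K → lab′ x z ≡ position lab F z) →
                Good lab′ (suc d) (K ∪ ⁅ x ⁆)
  good-insert {K = K} ([] ∉K) x∉K _ = single (q⊆p∪q K ⁅ x ⁆ (x∈⁅x⁆ x)) (empty ∉)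
    where
    ∉ : ∀ z → z ∉ (K ∪ ⁅ x ⁆) - x
    ∉ z z∈ with x∈p∪q⁻ K ⁅ x ⁆ (x∈p-y⇒x∈p z∈)
    ... | inj₁ z∈K = ∉K z z∈K
    ... | inj₂ z∈x = x∈p-y⇒x≢y {p = K ∪ ⁅ x ⁆} z∈ (x∈⁅y⁆⇒x≡y x z∈x)
  good-insert {K = K} (add y y∈K g F) x∉K eq =
    pair (λ { refl → x∉K y∈K }) (q⊆p∪q K ⁅ x ⁆ (x∈⁅x⁆ x)) (p⊆p∪q ⁅ x ⁆ y∈K)
      (trans (eq y∈K) (position-top y y∈K g F))
      (subst (Good lab′ _) (⊆-antisym to₁ from₁) (good-keep x∉K g))
      (subst (Good lab′ _) (⊆-antisym to₂ from₂)
        (good-insert F (λ x∈ → x∉K (x∈p-y⇒x∈p x∈))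
          λ z∈ → trans (eq (x∈p-y⇒x∈p z∈)) (position-rest y y∈K g F (x∈p-y⇒x≢y {p = K} z∈))))
    where
    to₁ : K ⊆ (K ∪ ⁅ x ⁆) - x
    to₁ z∈K = x∈p∧x≢y⇒x∈p-y (p⊆p∪q ⁅ x ⁆ z∈K) λ { refl → x∉K z∈K }
    from₁ : (K ∪ ⁅ x ⁆) - x ⊆ K
    from₁ z∈ with x∈p∪q⁻ K ⁅ x ⁆ (x∈p-y⇒x∈p z∈)
    ... | inj₁ z∈K = z∈K
    ... | inj₂ z∈x = ⊥-elim (x∈p-y⇒x≢y {p = K ∪ ⁅ x ⁆} z∈ (x∈⁅y⁆⇒x≡y x z∈x))
    to₂ : (K - y) ∪ ⁅ x ⁆ ⊆ (K ∪ ⁅ x ⁆) - y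
    to₂ z∈ with x∈p∪q⁻ (K - y) ⁅ x ⁆ z∈
    ... | inj₁ z∈K = x∈p∧x≢y⇒x∈p-y (p⊆p∪q ⁅ x ⁆ (x∈p-y⇒x∈p z∈K)) (x∈p-y⇒x≢y {p = K} z∈K)
    ... | inj₂ z∈x with x∈⁅y⁆⇒x≡y x z∈x
    ... | refl = x∈p∧x≢y⇒x∈p-y (q⊆p∪q K ⁅ x ⁆ z∈x) λ { refl → x∉K y∈K }
    from₂ : (K ∪ ⁅ x ⁆) - y ⊆ (K - y) ∪ ⁅ x ⁆
    from₂ z∈ with x∈p∪q⁻ K ⁅ x ⁆ (x∈p-y⇒x∈p z∈)
    ... | inj₁ z∈K = p⊆p∪q ⁅ x ⁆ (x∈p∧x≢y⇒x∈p-y z∈K (x∈p-y⇒x≢y {p = K ∪ ⁅ x ⁆} z∈))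
    ... | inj₂ z∈x = q⊆p∪q (K - y) ⁅ x ⁆ z∈x

  -- Below a member the flag is again a flag with the same positions, so `good-insert` applies to
  -- its tail.
  good-insert-member : ∀ {d K Y} (F : Flag lab d K) → x ∉ K →
                       (∀ {z} → z ∈ K → lab′ x z ≡ position lab F z) →
                       Member lab Y F → ∃ λ d′ → Good lab′ d′ (Y ∪ ⁅ x ⁆)
  good-insert-member F@([] _) x∉K eq refl = _ , good-insert F x∉K eq
  good-insert-member F@(add _ _ _ _) x∉K eq (inj₁ refl) = _ , good-insert F x∉K eq
  good-insert-member {K = K} (add y y∈K g F) x∉K eq (inj₂ m) =
    good-insert-member F (λ x∈ → x∉K (x∈p-y⇒x∈p x∈))
      (λ z∈ → trans (eq (x∈p-y⇒x∈p z∈)) (position-rest y y∈K g F (x∈p-y⇒x≢y {p = K} z∈))) m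

-- Adding one vertex to an MAT-labeled graph

inE⁺ : ∀ {G : Graph n} (L : Labeling G) {k u v} → adj G u v ≡ true → lab L u v ≤ k → inE L k u v ≡ true
inE⁺ L uv l = ∧-true⁺ uv (≤ᵇ-true⁺ l)

inE⁻ : ∀ {G : Graph n} (L : Labeling G) {k u v} → inE L k u v ≡ true → adj G u v ≡ true × lab L u v ≤ k
inE⁻ L e = let uv , l = ∧-true⁻ e in uv , ≤ᵇ-true⁻ l

≤pred⇒< : ∀ {m k} → 1 ≤ k → m ≤ k ∸ 1 → m < k
≤pred⇒< (s≤s z≤n) m≤ = s≤s m≤

-- H arises from G by joining the isolated vertex x to a clique, whose vertices are numbered by σ.
record OneVertexExtension (G H : Graph n) (L : Labeling G) (x : Fin n) (σ : Fin n → ℕ) : Set where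
  field
    isolated  : ∀ v → adj G x v ≡ false
    same      : ∀ {u v} → u ≢ x → v ≢ x → adj H u v ≡ adj G u v
    clique    : ∀ {u v} → adj H x u ≡ true → adj H x v ≡ true → u ≢ v → adj G u v ≡ true
    positive  : ∀ {u} → adj H x u ≡ true → 1 ≤ σ u
    injective : ∀ {u v} → adj H x u ≡ true → adj H x v ≡ true → σ u ≡ σ v → u ≡ v
    -- Yields (ML2) and (ML3) at `x`, and keeps `x` out of the triangles counted for old edges.
    dominates : ∀ {u v} → adj H x u ≡ true → adj H x v ≡ true → u ≢ v → lab L u v < σ u ⊎ lab L u v < σ v
    initial   : ∀ {u} → adj H x u ≡ true → countB (λ w → adj H x w ∧ (σ w ≤ᵇ (σ u ∸ 1))) ≡ σ u ∸ 1

abstract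

  extendLab : (Fin n → Fin n → ℕ) → Fin n → (Fin n → ℕ) → Fin n → Fin n → ℕ
  extendLab l x σ u v = if does (u Fin.≟ x) then σ v else if does (v Fin.≟ x) then σ u else l u v

  extendLab-xˡ : ∀ (l : Fin n → Fin n → ℕ) x σ v → extendLab l x σ x v ≡ σ v
  extendLab-xˡ l x σ v rewrite dec-true (x Fin.≟ x) refl = refl

  extendLab-xʳ : ∀ (l : Fin n → Fin n → ℕ) x σ u → extendLab l x σ u x ≡ σ u
  extendLab-xʳ l x σ u with u Fin.≟ x
  ... | yes refl = refl
  ... | no _ rewrite dec-true (x Fin.≟ x) refl = refl

  extendLab-old : ∀ (l : Fin n → Fin n → ℕ) x σ {u v} → u ≢ x → v ≢ x → extendLab l x σ u v ≡ l u v
  extendLab-old l x σ {u} {v} u≢x v≢x rewrite dec-false (u Fin.≟ x) u≢x | dec-false (v Fin.≟ x) v≢x = refl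

  extendLab-sym : ∀ (l : Fin n → Fin n → ℕ) x σ → (∀ u v → l u v ≡ l v u) →
                  ∀ u v → extendLab l x σ u v ≡ extendLab l x σ v u
  extendLab-sym l x σ l-sym u v with u Fin.≟ x | v Fin.≟ x
  ... | yes refl | yes refl = refl
  ... | yes refl | no _ = refl
  ... | no _ | yes refl = refl
  ... | no _ | no _ = l-sym u v

module Extend {G H : Graph n} {L : Labeling G} {x : Fin n} {σ : Fin n → ℕ}
              (ext : OneVertexExtension G H L x σ) where
  open OneVertexExtension ext

  ≢x : ∀ {u} → adj H x u ≡ true → u ≢ x
  ≢x xu u≡x = adj⇒≢ H xu (sym u≡x)

  extend : Labeling H
  extend = record
    { lab = extendLab (lab L) x σ
    ; lab-sym = extendLab-sym (lab L) x σ (lab-sym L)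
    ; lab-pos = pos }
    where
    pos : ∀ u v → adj H u v ≡ true → 1 ≤ extendLab (lab L) x σ u v
    pos u v uv with u Fin.≟ x | v Fin.≟ x
    ... | yes refl | _ = subst (1 ≤_) (sym (extendLab-xˡ (lab L) x σ v)) (positive uv)
    ... | no _ | yes refl = subst (1 ≤_) (sym (extendLab-xʳ (lab L) x σ u)) (positive (adj-flip H uv))
    ... | no u≢x | no v≢x = subst (1 ≤_) (sym (extendLab-old (lab L) x σ u≢x v≢x))
                              (lab-pos L u v (trans (sym (same u≢x v≢x)) uv))

  lab-xˡ : ∀ v → lab extend x v ≡ σ v
  lab-xˡ = extendLab-xˡ (lab L) x σ

  lab-xʳ : ∀ u → lab extend u x ≡ σ u
  lab-xʳ = extendLab-xʳ (lab L) x σ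

  lab-old : ∀ {u v} → u ≢ x → v ≢ x → lab extend u v ≡ lab L u v
  lab-old = extendLab-old (lab L) x σ

  π-old : ∀ {k u v} → u ≢ x → v ≢ x → π extend k u v → π L k u v
  π-old u≢x v≢x (uv , l) = trans (sym (same u≢x v≢x)) uv , trans (sym (lab-old u≢x v≢x)) l

  π-x : ∀ {k v} → π extend k x v → adj H x v ≡ true × σ v ≡ k
  π-x {v = v} (xv , l) = xv , trans (sym (lab-xˡ v)) l

  π-sym : ∀ {k u v} → π extend k u v → π extend k v u
  π-sym {u = u} {v} (uv , l) = adj-flip H uv , trans (lab-sym extend v u) l

  inE-old : ∀ {k u v} → u ≢ x → v ≢ x → inE extend k u v ≡ inE L k u v
  inE-old u≢x v≢x = cong₂ (λ a l → a ∧ (l ≤ᵇ _)) (same u≢x v≢x) (lab-old u≢x v≢x)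

  module _ (mat : IsMATLabeling L) where
    open IsMATLabeling mat

    -- A cycle through `x` would use two edges at `x` with one label, against injectivity of `σ`.
    ML1′ : ∀ k → 1 ≤ k → Forest (π extend k)
    ML1′ k 1≤k (m , c , c-inj , path , closing) with Fin.any? (λ i → c i Fin.≟ x)
    ... | no ¬x = ML1 k 1≤k (m , c , c-inj , (λ i → old (path i)) , old closing)
      where
      old : ∀ {i j} → π extend k (c i) (c j) → π L k (c i) (c j)
      old {i} {j} = π-old (λ eq → ¬x (i , eq)) (λ eq → ¬x (j , eq))
    ... | yes (i , refl) =
      let j , j′ , j≢j′ , p , q = cycle-neighbours (π extend k) c path closing i
          xj , σj = π-x (π-sym p)
          xj′ , σj′ = π-x q
      in j≢j′ (c-inj (injective xj xj′ (trans σj (sym σj′))))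

    -- At most one edge at `x` has label `k`, so a path through `x` leaves it by the vertex it came
    -- from, and the detour can be cut out.
    avoid-x : ∀ {k u v} → v ≢ x → Star (π extend k) u v →
              (u ≢ x → Star (π L k) u v) ×
              (u ≡ x → ∀ {t} → adj H x t ≡ true → σ t ≡ k → Star (π L k) t v)
    avoid-x v≢x ε = (λ _ → ε) , λ u≡x → ⊥-elim (v≢x u≡x)
    avoid-x {k} {u} {v} v≢x (_◅_ {j = w} p ps) = from-old , from-x
      where
      rec = avoid-x v≢x ps
      from-old : u ≢ x → Star (π L k) u v
      from-old u≢x with w Fin.≟ x
      ... | yes refl = let xu , σu = π-x (π-sym p) in proj₂ rec refl xu σu
      ... | no w≢x = π-old u≢x w≢x p ◅ proj₁ rec w≢x
      from-x : u ≡ x → ∀ {t} → adj H x t ≡ true → σ t ≡ k → Star (π L k) t v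
      from-x refl {t} xt σt =
        let xw , σw = π-x p
        in subst (λ t → Star (π L k) t v) (injective xw xt (trans σw (sym σt))) (proj₁ rec (≢x xw))

    -- The path leaves `x` through some `w` of position `k` and leads on to `v` within the old edges
    -- of label `k`. But `wv` is an old edge of smaller label, against (ML2) for `L`.
    ML2-x : ∀ k → 1 ≤ k → ∀ v → cl H (π extend k) x v → lab extend x v ≤ k ∸ 1 → ⊥
    ML2-x k 1≤k .x (xx , ε) _ = ≢x xx refl
    ML2-x k 1≤k v (xv , star@(_◅_ {j = w} p ps)) l =
      ML2 k 1≤k w v ((wv , proj₂ (avoid-x (≢x xv) star) refl xw σw) , inE⁺ L wv small)
      where
      xw = proj₁ (π-x p)
      σw = proj₂ (π-x p)
      σv<k : σ v < k
      σv<k = ≤pred⇒< 1≤k (subst (_≤ k ∸ 1) (lab-xˡ v) l)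
      w≢v : w ≢ v
      w≢v refl = <-irrefl σw σv<k
      wv = clique xw xv w≢v
      small : lab L w v ≤ k ∸ 1
      small with dominates xw xv w≢v
      ... | inj₁ l<σw = <⇒≤pred (subst (lab L w v <_) σw l<σw)
      ... | inj₂ l<σv = <⇒≤pred (<-trans l<σv σv<k)

    ML2′ : ∀ k → 1 ≤ k → ∀ u v → ¬ (cl H (π extend k) u v × E extend (k ∸ 1) u v)
    ML2′ k 1≤k u v ((uv , star) , small) with u Fin.≟ x | v Fin.≟ x
    ... | yes refl | _ = ML2-x k 1≤k v (uv , star) (proj₂ (inE⁻ extend small))
    ... | no _ | yes refl = ML2-x k 1≤k u (adj-flip H uv , reverse π-sym star)
                              (subst (_≤ k ∸ 1) (lab-sym extend u x) (proj₂ (inE⁻ extend small)))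
    ... | no u≢x | no v≢x = ML2 k 1≤k u v
      ((trans (sym (same u≢x v≢x)) uv , proj₁ (avoid-x v≢x star) u≢x) ,
       trans (sym (inE-old u≢x v≢x)) small)

    -- The common neighbours are exactly the vertices of smaller position: the clique supplies the
    -- edge to `u`, and `dominates` bounds its label.
    ML3-x : ∀ k → 1 ≤ k → ∀ u → π extend k x u →
            countB (λ w → inE extend (k ∸ 1) x w ∧ inE extend (k ∸ 1) u w) ≡ k ∸ 1
    ML3-x k 1≤k u p with π-x p
    ... | xu , refl = trans (countB-cong λ w → bool-ext (to w) (from w)) (initial xu)
      where
      to : ∀ w → inE extend (k ∸ 1) x w ∧ inE extend (k ∸ 1) u w ≡ true → adj H x w ∧ (σ w ≤ᵇ (k ∸ 1)) ≡ true
      to w e = let xw , l = inE⁻ extend (proj₁ (∧-true⁻ e))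
               in ∧-true⁺ xw (≤ᵇ-true⁺ (subst (_≤ k ∸ 1) (lab-xˡ w) l))
      from : ∀ w → adj H x w ∧ (σ w ≤ᵇ (k ∸ 1)) ≡ true → inE extend (k ∸ 1) x w ∧ inE extend (k ∸ 1) u w ≡ true
      from w e = ∧-true⁺ (inE⁺ extend xw (subst (_≤ k ∸ 1) (sym (lab-xˡ w)) σw≤))
                         (inE⁺ extend (trans (same (≢x xu) (≢x xw)) (clique xu xw u≢w))
                               (subst (_≤ k ∸ 1) (sym (lab-old (≢x xu) (≢x xw))) small))
        where
        xw = proj₁ (∧-true⁻ e)
        σw≤ : σ w ≤ k ∸ 1
        σw≤ = ≤ᵇ-true⁻ (proj₂ (∧-true⁻ e))
        σw<k = ≤pred⇒< 1≤k σw≤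
        u≢w : u ≢ w
        u≢w refl = <-irrefl refl σw<k
        small : lab L u w ≤ k ∸ 1
        small with dominates xu xw u≢w
        ... | inj₁ l<k = <⇒≤pred l<k
        ... | inj₂ l<σw = <⇒≤pred (<-trans l<σw σw<k)

    ML3′ : ∀ k → 1 ≤ k → ∀ u u′ → π extend k u u′ →
           countB (λ w → inE extend (k ∸ 1) u w ∧ inE extend (k ∸ 1) u′ w) ≡ k ∸ 1
    ML3′ k 1≤k u u′ p with u Fin.≟ x | u′ Fin.≟ x
    ... | yes refl | _ = ML3-x k 1≤k u′ p
    ... | no _ | yes refl =
      trans (countB-cong λ w → ∧-comm (inE extend (k ∸ 1) u w) _) (ML3-x k 1≤k u (π-sym p))
    ... | no u≢x | no u′≢x = trans (countB-cong same-count) (ML3 k 1≤k u u′ q)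
      where
      q = π-old u≢x u′≢x p
      same-count : ∀ w → inE extend (k ∸ 1) u w ∧ inE extend (k ∸ 1) u′ w ≡ inE L (k ∸ 1) u w ∧ inE L (k ∸ 1) u′ w
      same-count w with w Fin.≟ x
      ... | no w≢x = cong₂ _∧_ (inE-old u≢x w≢x) (inE-old u′≢x w≢x)
      -- The new vertex is not counted before either: by `dominates`, its edges to `u` and `u′`
      -- cannot both have labels below that of `uu′`.
      ... | yes refl = trans (¬-not new-false) (sym (¬-not old-false))
        where
        old-false : inE L (k ∸ 1) u x ∧ inE L (k ∸ 1) u′ x ≡ true → ⊥
        old-false e = false≢true (adj-flip G (isolated u)) (proj₁ (inE⁻ L (proj₁ (∧-true⁻ e))))
        new-false : inE extend (k ∸ 1) u x ∧ inE extend (k ∸ 1) u′ x ≡ true → ⊥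
        new-false e with ∧-true⁻ e
        ... | e₁ , e₂ with inE⁻ extend e₁ | inE⁻ extend e₂
        ... | ux , l₁ | u′x , l₂ with dominates (adj-flip H ux) (adj-flip H u′x) (adj⇒≢ H (proj₁ p))
        ... | inj₁ l< = <⇒≱ (subst (_< σ u) (proj₂ q) l<) (<⇒≤ (≤pred⇒< 1≤k (subst (_≤ k ∸ 1) (lab-xʳ u) l₁)))
        ... | inj₂ l< = <⇒≱ (subst (_< σ u′) (proj₂ q) l<) (<⇒≤ (≤pred⇒< 1≤k (subst (_≤ k ∸ 1) (lab-xʳ u′) l₂)))

    extend-MAT : IsMATLabeling extend
    extend-MAT = record { ML1 = ML1′ ; ML2 = ML2′ ; ML3 = ML3′ }

MAT-transport : ∀ {G H : Graph n} → (∀ u v → adj G u v ≡ adj H u v) → HasMATLabeling G → HasMATLabeling H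
MAT-transport {G = G} {H} eq (L , mat) = L′ , record
  { ML1 = λ k 1≤k (m , c , c-inj , path , closing) →
      ML1 k 1≤k (m , c , c-inj , (λ i → π-eq (path i)) , π-eq closing)
  ; ML2 = λ k 1≤k u v ((uv , star) , e) →
      ML2 k 1≤k u v ((trans (eq u v) uv , Star.map π-eq star) , trans (inE-eq u v) e)
  ; ML3 = λ k 1≤k u u′ p → trans (countB-cong λ w → sym (cong₂ _∧_ (inE-eq u w) (inE-eq u′ w))) (ML3 k 1≤k u u′ (π-eq p)) }
  where
  open IsMATLabeling mat
  L′ : Labeling H
  L′ = record { lab = lab L ; lab-sym = lab-sym L ; lab-pos = λ u v uv → lab-pos L u v (trans (eq u v) uv) }
  π-eq : ∀ {k u v} → π L′ k u v → π L k u v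
  π-eq {u = u} {v} (uv , l) = trans (eq u v) uv , l
  inE-eq : ∀ {k} u v → inE L k u v ≡ inE L′ k u v
  inE-eq u v = cong (_∧ _) (eq u v)

-- Elimination through nest points

-- Vertices outside `V` remain as isolated ones, so the elimination never changes the vertex type.
restrict : Graph n → Subset n → Graph n
restrict G V = record
  { adj = λ u v → lookup V u ∧ lookup V v ∧ adj G u v
  ; adj-sym = λ u v → bool-ext (swap u v) (swap v u)
  ; adj-irr = λ u → ¬-not λ e →
      adj⇒≢ G {u} (proj₂ (∧-true⁻ {lookup V u} (proj₂ (∧-true⁻ {lookup V u} e)))) refl }
  where
  swap : ∀ u v → lookup V u ∧ lookup V v ∧ adj G u v ≡ true → lookup V v ∧ lookup V u ∧ adj G v u ≡ true
  swap u v e = let u∈ , e′ = ∧-true⁻ {lookup V u} e ; v∈ , uv = ∧-true⁻ {lookup V v} e′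
               in ∧-true⁺ v∈ (∧-true⁺ u∈ (trans (adj-sym G v u) uv))

restrict⁺ : ∀ (G : Graph n) V {u v} → u ∈ V → v ∈ V → adj G u v ≡ true → adj (restrict G V) u v ≡ true
restrict⁺ G V u∈V v∈V uv = ∧-true⁺ ([]=⇒lookup u∈V) (∧-true⁺ ([]=⇒lookup v∈V) uv)

restrict⁻ : ∀ (G : Graph n) V {u v} → adj (restrict G V) u v ≡ true → u ∈ V × v ∈ V × adj G u v ≡ true
restrict⁻ G V {u} {v} e = let u∈ , e′ = ∧-true⁻ e ; v∈ , uv = ∧-true⁻ e′
                          in lookup⇒[]= u V u∈ , lookup⇒[]= v V v∈ , uv

IsClique : Graph n → Subset n → Set
IsClique G K = ∀ u v → u ∈ K → v ∈ K → u ≢ v → adj G u v ≡ true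

module _ {G : Graph n} {𝓗 : Subset n → Set} (𝓗? : Decidable 𝓗) (tb : TotallyBalanced 𝓗)
         (cliques : ∀ {f} → 𝓗 f → IsClique G f)
         (covered : ∀ u v → u ≡ v ⊎ adj G u v ≡ true → ∃ λ f → 𝓗 f × u ∈ f × v ∈ f) where

  GoodLabeling : Subset n → Set
  GoodLabeling V = Σ (Labeling (restrict G V)) λ L →
    IsMATLabeling L × (∀ f → 𝓗 f → ∃ λ d → Good (lab L) d (V ∩ f))

  module AddNestPoint {V : Subset n} {x : Fin n} (x∈V : x ∈ V) (nest : NestPoint 𝓗 V x)
                      (L : Labeling (restrict G (V - x))) (L-MAT : IsMATLabeling L)
                      (L-good : ∀ f → 𝓗 f → ∃ λ d → Good (lab L) d ((V - x) ∩ f)) where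

    V⁻ : Subset n
    V⁻ = V - x

    𝒞 : Subset n → Set
    𝒞 Y = ∃ λ f → 𝓗 f × x ∈ f × Y ≡ V⁻ ∩ f

    𝒞? : Decidable 𝒞
    𝒞? Y = anySubset? λ f → 𝓗? f ×-dec (x ∈? f) ×-dec ≡-dec Bool._≟_ Y (V⁻ ∩ f)

    𝒞-good : ∀ {Y} → 𝒞 Y → ∃ λ d → Good (lab L) d Y
    𝒞-good (f , f∈𝓗 , _ , refl) = L-good f f∈𝓗

    shrink : ∀ {f g} → V ∩ f ⊆ g → V⁻ ∩ f ⊆ V⁻ ∩ g
    shrink {f} f⊆g z∈ = let z∈V⁻ , z∈f = x∈p∩q⁻ V⁻ f z∈
                        in x∈p∩q⁺ (z∈V⁻ , f⊆g (x∈p∩q⁺ (x∈p-y⇒x∈p z∈V⁻ , z∈f)))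

    𝒞-chain : ∀ {Y Z} → 𝒞 Y → 𝒞 Z → Y ⊆ Z ⊎ Z ⊆ Y
    𝒞-chain (f , f∈𝓗 , x∈f , refl) (g , g∈𝓗 , x∈g , refl) with nest f g f∈𝓗 g∈𝓗 x∈f x∈g
    ... | inj₁ f⊆g = inj₁ (shrink f⊆g)
    ... | inj₂ g⊆f = inj₂ (shrink g⊆f)

    largest : ∃ λ f → (𝓗 f × x ∈ f) × (∀ g → 𝓗 g × x ∈ g → ∣ V ∩ g ∣ ≤ ∣ V ∩ f ∣)
    largest = argmax anySubset? (λ f → 𝓗? f ×-dec (x ∈? f)) (λ f → ∣ V ∩ f ∣) n (λ f → ∣p∣≤n (V ∩ f))
                -- The diagonal case of `covered` gives a hyperedge through `x` even if `x` has no
                -- neighbour.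
                (let f , f∈𝓗 , x∈f , _ = covered x x (inj₁ refl) in f , f∈𝓗 , x∈f)

    top : Subset n
    top = proj₁ largest

    top∈𝓗 : 𝓗 top
    top∈𝓗 = proj₁ (proj₁ (proj₂ largest))

    x∈top : x ∈ top
    x∈top = proj₂ (proj₁ (proj₂ largest))

    ⊆top : ∀ {g} → 𝓗 g → x ∈ g → V ∩ g ⊆ top
    ⊆top {g} g∈𝓗 x∈g {z} z∈ with nest g top g∈𝓗 top∈𝓗 x∈g x∈top
    ... | inj₁ g⊆top = g⊆top z∈
    ... | inj₂ top⊆g = decidable-stable (z ∈? top) λ z∉top →
      let a , a∈ , a∉ = card-exchange (proj₂ (proj₂ largest) g (g∈𝓗 , x∈g)) z∈
                          λ z∈′ → z∉top (proj₂ (x∈p∩q⁻ V top z∈′))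
      in a∉ (x∈p∩q⁺ (proj₁ (x∈p∩q⁻ V top a∈) , top⊆g a∈))

    -- The neighbourhood of `x` in `V`, and a clique: nestedness puts every hyperedge through `x`,
    -- hence every edge at `x`, inside `top`.
    K : Subset n
    K = V⁻ ∩ top

    x∉K : x ∉ K
    x∉K x∈K = x∉p-x {p = V} (proj₁ (x∈p∩q⁻ V⁻ top x∈K))

    adj⇒∈K : ∀ {u} → adj (restrict G V) x u ≡ true → u ∈ K
    adj⇒∈K {u} xu =
      let _ , u∈V , e = restrict⁻ G V xu
          f , f∈𝓗 , x∈f , u∈f = covered x u (inj₂ e)
      in x∈p∩q⁺ (x∈p∧x≢y⇒x∈p-y u∈V (λ u≡x → adj⇒≢ G e (sym u≡x)) , ⊆top f∈𝓗 x∈f (x∈p∩q⁺ (u∈V , u∈f)))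

    ∈K⇒adj : ∀ {u} → u ∈ K → adj (restrict G V) x u ≡ true
    ∈K⇒adj u∈K = let u∈V⁻ , u∈top = x∈p∩q⁻ V⁻ top u∈K in
      restrict⁺ G V x∈V (x∈p-y⇒x∈p u∈V⁻) (cliques top∈𝓗 _ _ x∈top u∈top λ { refl → x∉K u∈K })

    d : ℕ
    d = proj₁ (L-good top top∈𝓗)

    through : Σ (Flag (lab L) d K) (Through (lab-sym L) 𝒞? 𝒞-good 𝒞-chain)
    through = flag-through (lab-sym L) 𝒞? 𝒞-good 𝒞-chain (proj₂ (L-good top top∈𝓗))

    F : Flag (lab L) d K
    F = proj₁ through

    σ : Fin n → ℕ
    σ = position (lab L) F

    initial-count : ∀ {u} → u ∈ K → countB (λ w → adj (restrict G V) x w ∧ (σ w ≤ᵇ (σ u ∸ 1))) ≡ σ u ∸ 1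
    initial-count {u} u∈K with position-prefix (lab-sym L) F (σ u ∸ 1)
                                 (≤-trans (m∸n≤m (σ u) 1) (proj₂ (position-bounds (lab-sym L) F u∈K)))
    ... | Y , ∣Y∣ , Y⁻ , Y⁺ = trans (countB-cong λ w → bool-ext (to w) (from w)) (trans (countB-lookup Y) ∣Y∣)
      where
      to : ∀ w → adj (restrict G V) x w ∧ (σ w ≤ᵇ (σ u ∸ 1)) ≡ true → lookup Y w ≡ true
      to w e = let xw , l = ∧-true⁻ e in []=⇒lookup (Y⁺ (adj⇒∈K xw) (≤ᵇ-true⁻ l))
      from : ∀ w → lookup Y w ≡ true → adj (restrict G V) x w ∧ (σ w ≤ᵇ (σ u ∸ 1)) ≡ true
      from w e = let w∈K , l = Y⁻ (lookup⇒[]= w Y e) in ∧-true⁺ (∈K⇒adj w∈K) (≤ᵇ-true⁺ l)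

    extension : OneVertexExtension (restrict G V⁻) (restrict G V) L x σ
    extension = record
      { isolated = λ v → ¬-not λ xv → x∉p-x {p = V} (proj₁ (restrict⁻ G V⁻ xv))
      ; same = λ u≢x v≢x → bool-ext
          (λ uv → let u∈V , v∈V , e = restrict⁻ G V uv
                  in restrict⁺ G V⁻ (x∈p∧x≢y⇒x∈p-y u∈V u≢x) (x∈p∧x≢y⇒x∈p-y v∈V v≢x) e)
          (λ uv → let u∈V , v∈V , e = restrict⁻ G V⁻ uv
                  in restrict⁺ G V (x∈p-y⇒x∈p u∈V) (x∈p-y⇒x∈p v∈V) e)
      ; clique = λ xu xv u≢v →
          let u∈V⁻ , u∈top = x∈p∩q⁻ V⁻ top (adj⇒∈K xu)
              v∈V⁻ , v∈top = x∈p∩q⁻ V⁻ top (adj⇒∈K xv)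
          in restrict⁺ G V⁻ u∈V⁻ v∈V⁻ (cliques top∈𝓗 _ _ u∈top v∈top u≢v)
      ; positive = λ xu → proj₁ (position-bounds (lab-sym L) F (adj⇒∈K xu))
      ; injective = λ xu xv → position-injective (lab-sym L) F (adj⇒∈K xu) (adj⇒∈K xv)
      ; dominates = λ xu xv → position-dominates (lab-sym L) F (adj⇒∈K xu) (adj⇒∈K xv)
      ; initial = λ xu → initial-count (adj⇒∈K xu) }

    open Extend extension

    agree : ∀ u v → u ≢ x → v ≢ x → lab L u v ≡ lab extend u v
    agree u v u≢x v≢x = sym (lab-old u≢x v≢x)

    good : ∀ f → 𝓗 f → ∃ λ d → Good (lab extend) d (V ∩ f)
    good f f∈𝓗 with x ∈? f
    ... | no x∉f = _ , subst (Good (lab extend) _) (⊆-antisym to from)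
                         (good-keep agree (λ x∈ → x∉f (proj₂ (x∈p∩q⁻ V⁻ f x∈))) (proj₂ (L-good f f∈𝓗)))
      where
      to : V⁻ ∩ f ⊆ V ∩ f
      to z∈ = let z∈V⁻ , z∈f = x∈p∩q⁻ V⁻ f z∈ in x∈p∩q⁺ (x∈p-y⇒x∈p z∈V⁻ , z∈f)
      from : V ∩ f ⊆ V⁻ ∩ f
      from z∈ = let z∈V , z∈f = x∈p∩q⁻ V f z∈ in x∈p∩q⁺ (x∈p∧x≢y⇒x∈p-y z∈V (λ { refl → x∉f z∈f }) , z∈f)
    ... | yes x∈f =
      -- The trace of `f` belongs to the chain `𝒞`, so it is a member of the flag.
      let d , g = good-insert-member agree F x∉K (λ {z} _ → lab-xˡ z)
                    (proj₂ through (V⁻ ∩ f) (f , f∈𝓗 , x∈f , refl) (shrink (⊆top f∈𝓗 x∈f)))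
      in d , subst (Good (lab extend) d) (⊆-antisym to from) g
      where
      to : (V⁻ ∩ f) ∪ ⁅ x ⁆ ⊆ V ∩ f
      to z∈ with x∈p∪q⁻ (V⁻ ∩ f) ⁅ x ⁆ z∈
      ... | inj₁ z∈Y = let z∈V⁻ , z∈f = x∈p∩q⁻ V⁻ f z∈Y in x∈p∩q⁺ (x∈p-y⇒x∈p z∈V⁻ , z∈f)
      ... | inj₂ z∈x with x∈⁅y⁆⇒x≡y x z∈x
      ... | refl = x∈p∩q⁺ (x∈V , x∈f)
      from : V ∩ f ⊆ (V⁻ ∩ f) ∪ ⁅ x ⁆
      from {z} z∈ with z Fin.≟ x
      ... | yes refl = q⊆p∪q (V⁻ ∩ f) ⁅ x ⁆ (x∈⁅x⁆ x)
      ... | no z≢x = let z∈V , z∈f = x∈p∩q⁻ V f z∈ in p⊆p∪q ⁅ x ⁆ (x∈p∩q⁺ (x∈p∧x≢y⇒x∈p-y z∈V z≢x , z∈f))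

    goodLabeling : GoodLabeling V
    goodLabeling = extend , extend-MAT L-MAT , good

  good-labeling : ∀ V → Acc _⊂_ V → GoodLabeling V
  good-labeling V (acc rec) with nonempty? V
  ... | yes (_ , v∈V) =
    let x , x∈V , nest = nest-point 𝓗? tb V v∈V
        L , L-MAT , L-good = good-labeling (V - x) (rec (x∈p⇒p-x⊂p x∈V))
    in AddNestPoint.goodLabeling x∈V nest L L-MAT L-good
  ... | no V-empty = L , mat , λ f _ → 0 , empty λ x x∈ → V-empty (x , proj₁ (x∈p∩q⁻ V f x∈))
    where
    L : Labeling (restrict G V)
    L = record { lab = λ _ _ → 1 ; lab-sym = λ _ _ → refl ; lab-pos = λ _ _ _ → s≤s z≤n }
    no-edge : ∀ {u v} → adj (restrict G V) u v ≡ true → ⊥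
    no-edge uv = V-empty (_ , proj₁ (restrict⁻ G V uv))
    mat : IsMATLabeling L
    mat = record
      { ML1 = λ _ _ (_ , _ , _ , _ , closing) → no-edge (proj₁ closing)
      ; ML2 = λ _ _ _ _ ((uv , _) , _) → no-edge uv
      ; ML3 = λ _ _ _ _ (uv , _) → ⊥-elim (no-edge uv) }

  MAT-labeling : HasMATLabeling G
  MAT-labeling = let L , L-MAT , _ = good-labeling full (⊂-wellFounded full)
                 in MAT-transport (λ u v → bool-ext (λ uv → proj₂ (proj₂ (restrict⁻ G full uv)))
                                                    (λ uv → restrict⁺ G full ∈⊤ ∈⊤ uv))
                                  (L , L-MAT)

-- Maximal cliques

MaximalClique : Graph n → Subset n → Set
MaximalClique G C = IsClique G C × (∀ w → (∀ u → u ∈ C → u ≢ w → adj G u w ≡ true) → w ∈ C)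

clique? : (G : Graph n) → Decidable (IsClique G)
clique? G C = Fin.all? λ u → Fin.all? λ v →
  (u ∈? C) →-dec (v ∈? C) →-dec ¬? (u Fin.≟ v) →-dec (adj G u v Bool.≟ true)

maximalClique? : (G : Graph n) → Decidable (MaximalClique G)
maximalClique? G C = clique? G C ×-dec Fin.all? λ w →
  Fin.all? (λ u → (u ∈? C) →-dec ¬? (u Fin.≟ w) →-dec (adj G u w Bool.≟ true)) →-dec (w ∈? C)

module _ (G : Graph n) where

  clique-insert : ∀ {K w} → IsClique G K → (∀ u → u ∈ K → u ≢ w → adj G u w ≡ true) → IsClique G (K ∪ ⁅ w ⁆)
  clique-insert {K} {w} K-clique w-adj u v u∈ v∈ u≢v with x∈p∪q⁻ K ⁅ w ⁆ u∈ | x∈p∪q⁻ K ⁅ w ⁆ v∈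
  ... | inj₁ u∈K | inj₁ v∈K = K-clique u v u∈K v∈K u≢v
  ... | inj₁ u∈K | inj₂ v∈w with x∈⁅y⁆⇒x≡y w v∈w
  ...   | refl = w-adj u u∈K u≢v
  clique-insert {K} {w} K-clique w-adj u v u∈ v∈ u≢v | inj₂ u∈w | v∈′ with x∈⁅y⁆⇒x≡y w u∈w | v∈′
  ...   | refl | inj₁ v∈K = adj-flip G (w-adj v v∈K λ v≡u → u≢v (sym v≡u))
  ...   | refl | inj₂ v∈w = ⊥-elim (u≢v (sym (x∈⁅y⁆⇒x≡y w v∈w)))

  extend-to-maximal : ∀ {K} → IsClique G K → ∃ λ C → MaximalClique G C × K ⊆ C
  extend-to-maximal {K} K-clique
    with argmax anySubset? (λ C → clique? G C ×-dec (K ⊆? C)) ∣_∣ n ∣p∣≤n (K , K-clique , λ z → z)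
  ... | C , (C-clique , K⊆C) , C-max = C , (C-clique , maximal) , K⊆C
    where
    maximal : ∀ w → (∀ u → u ∈ C → u ≢ w → adj G u w ≡ true) → w ∈ C
    maximal w w-adj = decidable-stable (w ∈? C) λ w∉C →
      <⇒≱ (p⊂q⇒∣p∣<∣q∣ (p⊆p∪q ⁅ w ⁆ , w , q⊆p∪q C ⁅ w ⁆ (x∈⁅x⁆ w) , w∉C))
          (C-max (C ∪ ⁅ w ⁆) (clique-insert C-clique w-adj , λ z∈K → p⊆p∪q ⁅ w ⁆ (K⊆C z∈K)))

  maximal-clique-cover : ∀ u v → u ≡ v ⊎ adj G u v ≡ true → ∃ λ C → MaximalClique G C × u ∈ C × v ∈ C
  maximal-clique-cover u v uv =
    let C , C-max , ⊆C = extend-to-maximal {⁅ u ⁆ ∪ ⁅ v ⁆} (clique-insert singleton (joined uv))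
    in C , C-max , ⊆C (p⊆p∪q ⁅ v ⁆ (x∈⁅x⁆ u)) , ⊆C (q⊆p∪q ⁅ u ⁆ ⁅ v ⁆ (x∈⁅x⁆ v))
    where
    singleton : IsClique G ⁅ u ⁆
    singleton a b a∈ b∈ a≢b = ⊥-elim (a≢b (trans (x∈⁅y⁆⇒x≡y u a∈) (sym (x∈⁅y⁆⇒x≡y u b∈))))
    joined : u ≡ v ⊎ adj G u v ≡ true → ∀ a → a ∈ ⁅ u ⁆ → a ≢ v → adj G a v ≡ true
    joined uv a a∈ a≢v with x∈⁅y⁆⇒x≡y u a∈
    joined (inj₁ u≡v) a a∈ a≢v | refl = ⊥-elim (a≢v u≡v)
    joined (inj₂ e)   a a∈ a≢v | refl = e

  -- Adjacent corners differ automatically; only the diagonals need distinctness assumptions.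
  no-square : Chordal G → ∀ {a b c d} → a ≢ c → b ≢ d →
              adj G a b ≡ true → adj G b c ≡ true → adj G c d ≡ true → adj G d a ≡ true →
              adj G a c ≡ false → adj G b d ≡ false → ⊥
  no-square chordal {a} {b} {c} {d} a≢c b≢d ab bc cd da ac bd = chordal 0 (f , (λ {i} {j} → f-inj i j) , f-adj)
    where
    f : Fin 4 → Fin n
    f = lookup (a ∷ b ∷ c ∷ d ∷ [])
    f-adj : ∀ i j → adj G (f i) (f j) ≡ Cyc 4 i j
    f-adj zero zero = adj-irr G a
    f-adj zero (suc zero) = ab
    f-adj zero (suc (suc zero)) = ac
    f-adj zero (suc (suc (suc zero))) = adj-flip G da
    f-adj (suc zero) zero = adj-flip G ab
    f-adj (suc zero) (suc zero) = adj-irr G b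
    f-adj (suc zero) (suc (suc zero)) = bc
    f-adj (suc zero) (suc (suc (suc zero))) = bd
    f-adj (suc (suc zero)) zero = adj-flip G ac
    f-adj (suc (suc zero)) (suc zero) = adj-flip G bc
    f-adj (suc (suc zero)) (suc (suc zero)) = adj-irr G c
    f-adj (suc (suc zero)) (suc (suc (suc zero))) = cd
    f-adj (suc (suc (suc zero))) zero = da
    f-adj (suc (suc (suc zero))) (suc zero) = adj-flip G bd
    f-adj (suc (suc (suc zero))) (suc (suc zero)) = adj-flip G cd
    f-adj (suc (suc (suc zero))) (suc (suc (suc zero))) = adj-irr G d
    f-inj : ∀ i j → f i ≡ f j → i ≡ j
    f-inj zero zero _ = refl
    f-inj zero (suc zero) eq = ⊥-elim (adj⇒≢ G ab eq)
    f-inj zero (suc (suc zero)) eq = ⊥-elim (a≢c eq)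
    f-inj zero (suc (suc (suc zero))) eq = ⊥-elim (adj⇒≢ G da (sym eq))
    f-inj (suc zero) zero eq = ⊥-elim (adj⇒≢ G ab (sym eq))
    f-inj (suc zero) (suc zero) _ = refl
    f-inj (suc zero) (suc (suc zero)) eq = ⊥-elim (adj⇒≢ G bc eq)
    f-inj (suc zero) (suc (suc (suc zero))) eq = ⊥-elim (b≢d eq)
    f-inj (suc (suc zero)) zero eq = ⊥-elim (a≢c (sym eq))
    f-inj (suc (suc zero)) (suc zero) eq = ⊥-elim (adj⇒≢ G bc (sym eq))
    f-inj (suc (suc zero)) (suc (suc zero)) _ = refl
    f-inj (suc (suc zero)) (suc (suc (suc zero))) eq = ⊥-elim (adj⇒≢ G cd eq)
    f-inj (suc (suc (suc zero))) zero eq = ⊥-elim (adj⇒≢ G da eq)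
    f-inj (suc (suc (suc zero))) (suc zero) eq = ⊥-elim (b≢d (sym eq))
    f-inj (suc (suc (suc zero))) (suc (suc zero)) eq = ⊥-elim (adj⇒≢ G cd (sym eq))
    f-inj (suc (suc (suc zero))) (suc (suc (suc zero))) _ = refl

  -- Square-freeness makes the traces on C of the neighbourhoods of X nested, so a vertex of C
  -- missed by the largest one is missed by all.
  common-non-neighbour :
    Chordal G → ∀ {C} → MaximalClique G C → {X : Fin n → Set} → Decidable X → ∃ X →
    (∀ {x} → X x → x ∉ C) → (∀ {x x′} → X x → X x′ → x ≢ x′ → adj G x x′ ≡ true) →
    ∃ λ w → w ∈ C × (∀ {x} → X x → adj G w x ≡ false)
  common-non-neighbour chordal {C} (C-clique , C-max) {X} X? ∃X X∉C X-clique
    with argmax Fin.any? X? (λ x → ∣ C ∩ N x ∣) n (λ x → ∣p∣≤n (C ∩ N x)) ∃X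
    where
    N : Fin n → Subset n
    N x = select λ w → adj G w x Bool.≟ true
  ... | x₀ , Xx₀ , x₀-max with Fin.any? (λ w → (w ∈? C) ×-dec (adj G w x₀ Bool.≟ false))
  -- If all of `C` is joined to `x₀`, maximality puts `x₀` into `C`.
  ... | no ¬w = ⊥-elim (X∉C Xx₀ (C-max x₀ λ u u∈C _ → ¬-not λ e → ¬w (u , u∈C , e)))
  ... | yes (w , w∈C , wx₀) = w , w∈C , λ Xx → ¬-not (conflict Xx)
    where
    conflict : ∀ {x} → X x → adj G w x ≡ true → ⊥
    conflict {x} Xx wx =
      -- `x` gains `w` over `x₀`, so it loses some `w′`; then `w`, `x`, `x₀`, `w′` form an induced
      -- square.
      let w′ , w′∈ , w′∉ = card-exchange (x₀-max x Xx)
                             (x∈p∩q⁺ (w∈C , ∈select⁺ (λ w → adj G w x Bool.≟ true) wx))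
                             λ w∈ → false≢true wx₀ (∈select⁻ (λ w → adj G w x₀ Bool.≟ true) (proj₂ (x∈p∩q⁻ C _ w∈)))
          w′∈C , w′∈N = x∈p∩q⁻ C _ w′∈
          w′x₀ = ∈select⁻ (λ w → adj G w x₀ Bool.≟ true) w′∈N
          w′x≢ = λ w′x → w′∉ (x∈p∩q⁺ (w′∈C , ∈select⁺ (λ w → adj G w x Bool.≟ true) w′x))
      in no-square chordal {w} {x} {x₀} {w′}
           (λ { refl → X∉C Xx₀ w∈C }) (λ x≡w′ → X∉C Xx (subst (_∈ C) (sym x≡w′) w′∈C))
           wx (X-clique Xx Xx₀ λ { refl → false≢true wx₀ wx }) (adj-flip G w′x₀)
           (C-clique w′ w w′∈C w∈C λ w′≡w → false≢true wx₀ (subst (λ t → adj G t x₀ ≡ true) w′≡w w′x₀))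
           wx₀ (adj-flip G (¬-not w′x≢))

-- Special cycles

least : {P : ℕ → Set} → Decidable P → ∀ {k} → P k → ∃ λ m → m ≤ k × P m × (∀ {j} → P j → m ≤ j)
least P? {k} pk with P? 0
least P? {k}     pk | yes p₀ = 0 , z≤n , p₀ , λ _ → z≤n
least P? {zero}  pk | no ¬p₀ = ⊥-elim (¬p₀ pk)
least {P} P? {suc k} pk | no ¬p₀ =
  let m , m≤k , pm , m-least = least (λ j → P? (suc j)) pk
  in suc m , s≤s m≤k , pm , λ { {zero} p₀ → ⊥-elim (¬p₀ p₀) ; {suc j} pj → s≤s (m-least pj) }

greatest : {P : ℕ → Set} → Decidable P → ∀ N {k} → k ≤ N → P k →
           ∃ λ m → k ≤ m × m ≤ N × P m × (∀ {j} → j ≤ N → P j → j ≤ m)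
greatest P? zero z≤n pk = 0 , z≤n , z≤n , pk , λ j≤0 _ → j≤0
greatest {P} P? (suc N) {k} k≤ pk with P? (suc N)
... | yes p = suc N , k≤ , ≤-refl , p , λ j≤ _ → j≤
... | no ¬p with m≤n⇒m<n∨m≡n k≤
... | inj₂ refl = ⊥-elim (¬p pk)
... | inj₁ (s≤s k≤N) =
  let m , k≤m , m≤N , pm , m-greatest = greatest P? N k≤N pk
  in m , k≤m , m≤n⇒m≤1+n m≤N , pm , λ j≤ pj → m-greatest (below j≤ pj) pj
  where
  below : ∀ {j} → j ≤ suc N → P j → j ≤ N
  below j≤ pj with m≤n⇒m<n∨m≡n j≤
  ... | inj₁ (s≤s j≤N) = j≤N
  ... | inj₂ refl = ⊥-elim (¬p pj)

module _ {𝓗 : Subset n → Set} where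

  -- The stretch from `p` to `p + g` is closed by `C` in place of `e`.
  subcycle : ∀ {K C} (sc : SpecialCycle 𝓗 K) → let open SpecialCycle sc in
             ∀ p g → p + g ≤ K → 𝓗 C → y p ∈ C → y (p + g) ∈ C →
             (∀ {s} → 0 < s → s < g → y (p + s) ∉ C) → SpecialCycle 𝓗 g
  subcycle {K} {C} sc p g p+g≤K C∈𝓗 yp∈C yq∈C gap = record
    { y = λ j → y (p + j) ; c = λ i → c (p + i) ; e = C
    ; c∈𝓗 = λ i<g → c∈𝓗 (shift i<g)
    ; e∈𝓗 = C∈𝓗
    ; left = λ i<g → left (shift i<g)
    ; right = λ {i} i<g → subst (λ t → y t ∈ c (p + i)) (sym (+-suc p i)) (right (shift i<g))
    ; only = λ {i} {j} i<g j≤g y∈ → cancel i j (only (shift i<g) (≤-trans (+-monoʳ-≤ p j≤g) p+g≤K) y∈)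
    ; first = subst (λ t → y t ∈ C) (sym (+-identityʳ p)) yp∈C
    ; last = yq∈C
    ; ends = ends′ }
    where
    open SpecialCycle sc
    shift : ∀ {i} → i < g → p + i < K
    shift i<g = ≤-trans (+-monoʳ-< p i<g) p+g≤K
    cancel : ∀ i j → p + j ≡ p + i ⊎ p + j ≡ suc (p + i) → j ≡ i ⊎ j ≡ suc i
    cancel i j (inj₁ eq) = inj₁ (+-cancelˡ-≡ p j i eq)
    cancel i j (inj₂ eq) = inj₂ (+-cancelˡ-≡ p j (suc i) (trans eq (sym (+-suc p i))))
    ends′ : ∀ {j} → j ≤ g → y (p + j) ∈ C → j ≡ 0 ⊎ j ≡ g
    ends′ {zero} _ _ = inj₁ refl
    ends′ {suc j} j≤g y∈C with m≤n⇒m<n∨m≡n j≤g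
    ... | inj₁ j<g = ⊥-elim (gap (s≤s z≤n) j<g y∈C)
    ... | inj₂ j≡g = inj₂ j≡g

  -- `C` takes the place of the stretch from `p` to `suc p + δ`, and its `δ` inner vertices
  -- disappear. As `C` has no cycle vertex beyond that stretch, no new incidence arises.
  contract : ∀ {K₀ K δ C} → K + δ ≡ K₀ → (sc : SpecialCycle 𝓗 K₀) → let open SpecialCycle sc in
             ∀ p → p < K → 1 ≤ δ → 𝓗 C → y p ∈ C → y (suc p + δ) ∈ C →
             (∀ {j} → j ≤ K₀ → y j ∈ C → p ≤ j × j ≤ suc p + δ) → SpecialCycle 𝓗 K
  contract {K = K} {δ} {C} refl sc p p<K 1≤δ C∈𝓗 yp∈C yq∈C within = record
    { y = y′ ; c = c′ ; e = e
    ; c∈𝓗 = c′∈𝓗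
    ; e∈𝓗 = e∈𝓗
    ; left = left′
    ; right = right′
    ; only = only′
    ; first = subst (_∈ e) (sym (y′-lo z≤n)) first
    ; last = subst (_∈ e) (sym (y′-hi p<K)) last
    ; ends = ends′ }
    where
    open SpecialCycle sc
    y′ : ℕ → Fin n
    y′ j = if does (j ≤? p) then y j else y (j + δ)
    y′-lo : ∀ {j} → j ≤ p → y′ j ≡ y j
    y′-lo {j} j≤p rewrite dec-true (j ≤? p) j≤p = refl
    y′-hi : ∀ {j} → p < j → y′ j ≡ y (j + δ)
    y′-hi {j} p<j rewrite dec-false (j ≤? p) (<⇒≱ p<j) = refl
    c′ : ℕ → Subset n
    c′ i with <-cmp i p
    ... | tri< _ _ _ = c i
    ... | tri≈ _ _ _ = C
    ... | tri> _ _ _ = c (i + δ)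
    <K+δ : ∀ {i} → i < K → i < K + δ
    <K+δ i<K = ≤-trans i<K (m≤m+n K δ)
    c′∈𝓗 : ∀ {i} → i < K → 𝓗 (c′ i)
    c′∈𝓗 {i} i<K with <-cmp i p
    ... | tri< _ _ _ = c∈𝓗 (<K+δ i<K)
    ... | tri≈ _ _ _ = C∈𝓗
    ... | tri> _ _ _ = c∈𝓗 (+-monoˡ-< δ i<K)
    left′ : ∀ {i} → i < K → y′ i ∈ c′ i
    left′ {i} i<K with <-cmp i p
    ... | tri< i<p _ _ = subst (_∈ c i) (sym (y′-lo (<⇒≤ i<p))) (left (<K+δ i<K))
    ... | tri≈ _ refl _ = subst (_∈ C) (sym (y′-lo ≤-refl)) yp∈C
    ... | tri> _ _ p<i = subst (_∈ c (i + δ)) (sym (y′-hi p<i)) (left (+-monoˡ-< δ i<K))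
    right′ : ∀ {i} → i < K → y′ (suc i) ∈ c′ i
    right′ {i} i<K with <-cmp i p
    ... | tri< i<p _ _ = subst (_∈ c i) (sym (y′-lo i<p)) (right (<K+δ i<K))
    ... | tri≈ _ refl _ = subst (_∈ C) (sym (y′-hi ≤-refl)) yq∈C
    ... | tri> _ _ p<i = subst (_∈ c (i + δ)) (sym (y′-hi (m<n⇒m<1+n p<i))) (right (+-monoˡ-< δ i<K))
    lo : ∀ {j s} → j ≤ p → y′ j ∈ s → y j ∈ s
    lo {s = s} j≤p = subst (_∈ s) (y′-lo j≤p)
    hi : ∀ {j s} → ¬ j ≤ p → y′ j ∈ s → y (j + δ) ∈ s
    hi {s = s} j≰p = subst (_∈ s) (y′-hi (≰⇒> j≰p))
    only′ : ∀ {i j} → i < K → j ≤ K → y′ j ∈ c′ i → j ≡ i ⊎ j ≡ suc i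
    only′ {i} {j} i<K j≤K y∈ with j ≤? p | <-cmp i p
    ... | yes j≤p | tri< i<p _ _ = only (<K+δ i<K) (≤-trans j≤K (m≤m+n K δ)) (lo j≤p y∈)
    ... | yes j≤p | tri≈ _ refl _ = inj₁ (≤-antisym j≤p (proj₁ (within (≤-trans j≤K (m≤m+n K δ)) (lo j≤p y∈))))
    ... | yes j≤p | tri> _ _ p<i with only (+-monoˡ-< δ i<K) (≤-trans j≤K (m≤m+n K δ)) (lo j≤p y∈)
    ...   | inj₁ refl = ⊥-elim (<⇒≱ p<i (≤-trans (m≤m+n i δ) j≤p))
    ...   | inj₂ refl = ⊥-elim (<⇒≱ p<i (≤-trans (≤-trans (m≤m+n i δ) (n≤1+n _)) j≤p))
    only′ {i} {j} i<K j≤K y∈ | no j≰p | tri< i<p _ _ with only (<K+δ i<K) (+-monoˡ-≤ δ j≤K) (hi j≰p y∈)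
    ...   | inj₁ eq = ⊥-elim (j≰p (≤-trans (m≤m+n j δ) (≤-trans (≤-reflexive eq) (<⇒≤ i<p))))
    ...   | inj₂ eq = ⊥-elim (j≰p (≤-trans (m≤m+n j δ) (≤-trans (≤-reflexive eq) i<p)))
    only′ {i} {j} i<K j≤K y∈ | no j≰p | tri≈ _ refl _ =
      inj₂ (≤-antisym (+-cancelʳ-≤ δ j (suc p) (proj₂ (within (+-monoˡ-≤ δ j≤K) (hi j≰p y∈)))) (≰⇒> j≰p))
    only′ {i} {j} i<K j≤K y∈ | no j≰p | tri> _ _ p<i with only (+-monoˡ-< δ i<K) (+-monoˡ-≤ δ j≤K) (hi j≰p y∈)
    ...   | inj₁ eq = inj₁ (+-cancelʳ-≡ δ j i eq)
    ...   | inj₂ eq = inj₂ (+-cancelʳ-≡ δ j (suc i) eq)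
    ends′ : ∀ {j} → j ≤ K → y′ j ∈ e → j ≡ 0 ⊎ j ≡ K
    ends′ {j} j≤K y∈ with j ≤? p
    ... | yes j≤p with ends (≤-trans j≤K (m≤m+n K δ)) (lo j≤p y∈)
    ...   | inj₁ j≡0 = inj₁ j≡0
    ...   | inj₂ refl = ⊥-elim (<⇒≱ p<K (≤-trans (m≤m+n K δ) j≤p))
    ends′ {j} j≤K y∈ | no j≰p with ends (+-monoˡ-≤ δ j≤K) (hi j≰p y∈)
    ...   | inj₁ eq = ⊥-elim (<⇒≱ 1≤δ (≤-trans (m≤n+m δ j) (≤-reflexive eq)))
    ...   | inj₂ eq = inj₂ (+-cancelʳ-≡ δ j K eq)

module MinimalCycle {𝓗 : Subset n → Set} {K : ℕ} (2≤K : 2 ≤ K) (sc : SpecialCycle 𝓗 K)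
                    (minimal : ∀ {K′} → K′ < K → 2 ≤ K′ → ¬ SpecialCycle 𝓗 K′) where
  open SpecialCycle sc

  -- Equal vertices would have consecutive indices by the hyperedge `c i`; the hyperedge after them,
  -- or `e` if `j = K`, then rules them out.
  y-distinct : ∀ {i j} → i < j → j ≤ K → y i ≢ y j
  y-distinct {i} {j} i<j j≤K yi≡yj with only i<K j≤K (subst (_∈ c i) yi≡yj (left i<K))
    where i<K = ≤-trans i<j j≤K
  ... | inj₁ refl = <-irrefl refl i<j
  ... | inj₂ refl with m≤n⇒m<n∨m≡n j≤K
  ...   | inj₁ j<K with only j<K (<⇒≤ (<-trans i<j j<K)) (subst (_∈ c j) (sym yi≡yj) (left j<K))
  ...     | inj₁ i≡j = <-irrefl i≡j i<j
  ...     | inj₂ i≡1+j = <-irrefl i≡1+j (m<n⇒m<1+n i<j)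
  y-distinct {i} {j} i<j j≤K yi≡yj | inj₂ refl | inj₂ refl with ends (<⇒≤ i<j) (subst (_∈ e) (sym yi≡yj) last)
  ...     | inj₁ refl = <-irrefl refl 2≤K
  ...     | inj₂ i≡j = <-irrefl i≡j i<j

  -- An inner vertex in `C` splits the stretch. If there is none and the stretch has length at least
  -- two, `C` closes it to a special cycle shorter than the minimal one.
  interval : ∀ {C} → 𝓗 C → ∀ g p → p + g ≤ K → g < K → y p ∈ C → y (p + g) ∈ C →
             ∀ r → r ≤ g → y (p + r) ∈ C
  interval {C} C∈𝓗 = <-rec _ body
    where
    body : ∀ g → (∀ {s} → s < g → ∀ p → p + s ≤ K → s < K → y p ∈ C → y (p + s) ∈ C →
                  ∀ r → r ≤ s → y (p + r) ∈ C) →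
           ∀ p → p + g ≤ K → g < K → y p ∈ C → y (p + g) ∈ C → ∀ r → r ≤ g → y (p + r) ∈ C
    body g rec p p+g≤K g<K yp∈C yq∈C r r≤g
      with anyUpTo? (λ s → (1 ≤? s) ×-dec (y (p + s) ∈? C)) g
    ... | yes (s , s<g , 0<s , ys∈C) with r ≤? s
    ...   | yes r≤s = rec s<g p (≤-trans (+-monoʳ-≤ p (<⇒≤ s<g)) p+g≤K) (<-trans s<g g<K) yp∈C ys∈C r r≤s
    ...   | no r≰s = subst (λ t → y t ∈ C) (shift (<⇒≤ (≰⇒> r≰s)))
              (rec (m∸s<m 0<s s<g) (p + s) (subst (_≤ K) (sym (shift (<⇒≤ s<g))) p+g≤K)
                   (≤-trans (s≤s (m∸n≤m g s)) g<K) ys∈C (subst (λ t → y t ∈ C) (sym (shift (<⇒≤ s<g))) yq∈C)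
                   (r ∸ s) (∸-monoˡ-≤ s r≤g))
      where
      shift : ∀ {t} → s ≤ t → p + s + (t ∸ s) ≡ p + t
      shift {t} s≤t = trans (+-assoc p s (t ∸ s)) (cong (p +_) (m+[n∸m]≡n s≤t))
      m∸s<m : 0 < s → s < g → g ∸ s < g
      m∸s<m 0<s s<g = ∸-monoʳ-< 0<s (<⇒≤ s<g)
    body g rec p p+g≤K g<K yp∈C yq∈C r r≤g | no ¬s with m≤n⇒m<n∨m≡n r≤g
    ... | inj₂ refl = yq∈C
    body g rec p p+g≤K g<K yp∈C yq∈C zero r≤g | no ¬s | inj₁ _ = subst (λ t → y t ∈ C) (sym (+-identityʳ p)) yp∈C
    body g rec p p+g≤K g<K yp∈C yq∈C (suc r) r≤g | no ¬s | inj₁ r<g =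
      ⊥-elim (minimal g<K (≤-trans (s≤s (s≤s z≤n)) r<g)
        (subcycle sc p g p+g≤K C∈𝓗 yp∈C yq∈C λ {s} 0<s s<g ys∈C → ¬s (s , s<g , 0<s , ys∈C)))

  -- Let `p₀` and `q₀` be the extreme indices of cycle vertices in `C`. If they were less than `K`
  -- apart, contracting the stretch between them would leave a shorter cycle, still with `2 ≤ K′`.
  -- So `C` contains `y 0` and `y K`, and `interval` fills the three stretches cut by `p` and
  -- `p + g`.
  chord⇒all : ∀ {C} → 𝓗 C → ∀ p g → p + g ≤ K → 2 ≤ g → g < K → y p ∈ C → y (p + g) ∈ C →
              ∀ j → j ≤ K → y j ∈ C
  chord⇒all {C} C∈𝓗 p g p+g≤K 2≤g g<K yp∈C yq∈C
    with least (λ j → y j ∈? C) yp∈C | greatest (λ j → y j ∈? C) K p+g≤K yq∈C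
  ... | p₀ , p₀≤p , yp₀∈C , p₀-least | q₀ , q≤q₀ , q₀≤K , yq₀∈C , q₀-greatest with m≤n⇒m<n∨m≡n (≤-trans (m∸n≤m q₀ p₀) q₀≤K)
  ... | inj₁ h<K = ⊥-elim (contradiction (q₀ ∸ p₀) (m+[n∸m]≡n (≤-trans p₀≤p (≤-trans (m≤m+n p g) q≤q₀))) h<K 2≤h)
    where
    2≤h : 2 ≤ q₀ ∸ p₀
    2≤h = ≤-trans 2≤g (≤-trans (≤-reflexive (sym (m+n∸m≡n p g))) (∸-mono q≤q₀ p₀≤p))
    contradiction : ∀ h → p₀ + h ≡ q₀ → h < K → 2 ≤ h → ⊥
    contradiction (suc δ) eq h<K (s≤s 1≤δ) = minimal K′<K 2≤K′
      (contract K≡ sc p₀ p₀<K′ 1≤δ C∈𝓗 yp₀∈C (subst (λ t → y t ∈ C) q₀≡ yq₀∈C)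
        λ {j} j≤K yj∈C → p₀-least yj∈C , subst (j ≤_) q₀≡ (q₀-greatest j≤K yj∈C))
      where
      K′ : ℕ
      K′ = K ∸ δ
      K≡ : K′ + δ ≡ K
      K≡ = m∸n+n≡m (<⇒≤ (<-trans (n<1+n δ) h<K))
      q₀≡ : q₀ ≡ suc p₀ + δ
      q₀≡ = trans (sym eq) (+-suc p₀ δ)
      p₀<K′ : p₀ < K′
      p₀<K′ = +-cancelʳ-≤ δ (suc p₀) K′ (subst₂ _≤_ q₀≡ (sym K≡) q₀≤K)
      K′<K : K′ < K
      K′<K = ∸-monoʳ-< 1≤δ (<⇒≤ (<-trans (n<1+n δ) h<K))
      2≤K′ : 2 ≤ K′
      2≤K′ = +-cancelʳ-≤ δ 2 K′ (subst (2 + δ ≤_) (sym K≡) h<K)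
  ... | inj₂ h≡K = all
    where
    p₀≡0 : p₀ ≡ 0
    p₀≡0 = n≤0⇒n≡0 (+-cancelʳ-≤ (q₀ ∸ p₀) p₀ 0
             (subst₂ _≤_ (sym (m+[n∸m]≡n (≤-trans p₀≤p (≤-trans (m≤m+n p g) q≤q₀)))) (sym h≡K) q₀≤K))
    y0∈C : y 0 ∈ C
    y0∈C = subst (λ t → y t ∈ C) p₀≡0 yp₀∈C
    yK∈C : y K ∈ C
    yK∈C = subst (λ t → y t ∈ C) (trans (cong (q₀ ∸_) (sym p₀≡0)) h≡K) yq₀∈C
    p<K : p < K
    p<K = ≤-trans (subst (_≤ p + g) (+-comm p 1) (+-monoʳ-≤ p (≤-trans (s≤s z≤n) 2≤g))) p+g≤K
    all : ∀ j → j ≤ K → y j ∈ C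
    all j j≤K with j ≤? p | j ≤? p + g
    ... | yes j≤p | _ = interval C∈𝓗 p 0 (<⇒≤ p<K) p<K y0∈C yp∈C j j≤p
    ... | no j≰p | yes j≤q = subst (λ t → y t ∈ C) (m+[n∸m]≡n (<⇒≤ (≰⇒> j≰p)))
      (interval C∈𝓗 g p p+g≤K g<K yp∈C yq∈C (j ∸ p)
        (≤-trans (∸-monoˡ-≤ p j≤q) (≤-reflexive (m+n∸m≡n p g))))
    ... | no _ | no j≰q = subst (λ t → y t ∈ C) (m+[n∸m]≡n (<⇒≤ (≰⇒> j≰q)))
      (interval C∈𝓗 (K ∸ (p + g)) (p + g) (≤-reflexive (m+[n∸m]≡n p+g≤K))
        (∸-monoʳ-< (≤-trans (≤-trans (s≤s z≤n) 2≤g) (m≤n+m g p)) p+g≤K)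
        yq∈C (subst (λ t → y t ∈ C) (sym (m+[n∸m]≡n p+g≤K)) yK∈C) (j ∸ (p + g)) (∸-monoˡ-≤ (p + g) j≤K))

-- Induced cycles and suns

cycAdj-cases : ∀ {m a b} → cycAdjℕ m a b ≡ true →
               suc a ≡ b ⊎ suc b ≡ a ⊎ (a ≡ 0 × suc b ≡ m) ⊎ (b ≡ 0 × suc a ≡ m)
cycAdj-cases {m} {a} {b} eq with ∨-true⁻ {suc a ≡ᵇ b} eq
... | inj₁ p = inj₁ (≡ᵇ-true⁻ p)
... | inj₂ eq₁ with ∨-true⁻ {suc b ≡ᵇ a} eq₁
... | inj₁ p = inj₂ (inj₁ (≡ᵇ-true⁻ p))
... | inj₂ eq₂ with ∨-true⁻ {(a ≡ᵇ 0) ∧ (suc b ≡ᵇ m)} eq₂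
... | inj₁ p = inj₂ (inj₂ (inj₁ (≡ᵇ-true⁻ (proj₁ (∧-true⁻ p)) , ≡ᵇ-true⁻ (proj₂ (∧-true⁻ {a ≡ᵇ 0} p)))))
... | inj₂ p = inj₂ (inj₂ (inj₂ (≡ᵇ-true⁻ (proj₁ (∧-true⁻ p)) , ≡ᵇ-true⁻ (proj₂ (∧-true⁻ {b ≡ᵇ 0} p)))))

cycAdj-next : ∀ m a → cycAdjℕ m a (suc a) ≡ true
cycAdj-next m a = ∨-true⁺ (inj₁ (≡ᵇ-true⁺ {suc a} refl))

cycAdj-closing : ∀ m → cycAdjℕ (suc m) 0 m ≡ true
cycAdj-closing m = ∨-true⁺ {1 ≡ᵇ m} (inj₂ (∨-true⁺ {suc m ≡ᵇ 0} (inj₂ (∨-true⁺ (inj₁ (≡ᵇ-true⁺ {m} refl))))))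

cycAdj-sym : ∀ m a b → cycAdjℕ m a b ≡ true → cycAdjℕ m b a ≡ true
cycAdj-sym m a b eq with cycAdj-cases {m} {a} {b} eq
... | inj₁ refl = ∨-true⁺ {suc b ≡ᵇ a} (inj₂ (∨-true⁺ (inj₁ (≡ᵇ-true⁺ {suc a} refl))))
... | inj₂ (inj₁ refl) = cycAdj-next m b
... | inj₂ (inj₂ (inj₁ (refl , refl))) =
  ∨-true⁺ {suc b ≡ᵇ 0} (inj₂ (∨-true⁺ {1 ≡ᵇ b} (inj₂ (∨-true⁺ {(b ≡ᵇ 0) ∧ _} (inj₂ (≡ᵇ-true⁺ {b} refl))))))
... | inj₂ (inj₂ (inj₂ (refl , refl))) = cycAdj-closing a

-- Incidence of the i-th hyperedge and the j-th vertex in a cycle of length 1 + K.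
Incident : ℕ → ℕ → ℕ → Set
Incident K i j = j ≡ i ⊎ j ≡ suc i ⊎ (j ≡ 0 × i ≡ K)

wuAdj⁺ : ∀ {K} (i j : Fin (suc K)) → Incident K (toℕ i) (toℕ j) → wuAdj (suc K) i j ≡ true
wuAdj⁺ i j (inj₁ eq) = ∨-true⁺ (inj₁ (≡ᵇ-true⁺ eq))
wuAdj⁺ i j (inj₂ (inj₁ eq)) = ∨-true⁺ {toℕ j ≡ᵇ toℕ i} (inj₂ (∨-true⁺ (inj₁ (≡ᵇ-true⁺ eq))))
wuAdj⁺ i j (inj₂ (inj₂ (j≡0 , i≡K))) =
  ∨-true⁺ {toℕ j ≡ᵇ toℕ i} (inj₂ (∨-true⁺ {toℕ j ≡ᵇ suc (toℕ i)}
    (inj₂ (∧-true⁺ (≡ᵇ-true⁺ j≡0) (≡ᵇ-true⁺ i≡K)))))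

wuAdj⁻ : ∀ {K} (i j : Fin (suc K)) → wuAdj (suc K) i j ≡ true → Incident K (toℕ i) (toℕ j)
wuAdj⁻ i j eq with ∨-true⁻ {toℕ j ≡ᵇ toℕ i} eq
... | inj₁ p = inj₁ (≡ᵇ-true⁻ p)
... | inj₂ eq₁ with ∨-true⁻ {toℕ j ≡ᵇ suc (toℕ i)} eq₁
... | inj₁ p = inj₂ (inj₁ (≡ᵇ-true⁻ p))
... | inj₂ p = inj₂ (inj₂ (≡ᵇ-true⁻ (proj₁ (∧-true⁻ p)) , ≡ᵇ-true⁻ (proj₂ (∧-true⁻ {toℕ j ≡ᵇ 0} p))))

-- Vertex `i` serves unless `i′` is the cyclic predecessor of `i`; then the cyclic successor of `i`
-- does, as the length is at least three.
separating : ∀ {K i i′} → 2 ≤ K → i ≤ K → i′ ≤ K → i ≢ i′ → ∃ λ j → j ≤ K × Incident K i j × ¬ Incident K i′ j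
separating {K} {i} {i′} 2≤K i≤K i′≤K i≢i′ with i ≟ suc i′
... | yes refl with m≤n⇒m<n∨m≡n i≤K
...   | inj₁ i<K = suc i , i<K , inj₂ (inj₁ refl) ,
  λ { (inj₁ eq) → <-irrefl (sym eq) (m<n⇒m<1+n (n<1+n i′)) ; (inj₂ (inj₁ eq)) → 1+n≢n eq }
...   | inj₂ refl = 0 , z≤n , inj₂ (inj₂ (refl , refl)) ,
  λ { (inj₁ refl) → <-irrefl refl 2≤K ; (inj₂ (inj₂ (_ , eq))) → 1+n≢n (sym eq) }
separating {K} {i} {i′} 2≤K i≤K i′≤K i≢i′ | no i≢1+i′ with i ≟ 0
... | no i≢0 = i , i≤K , inj₁ refl ,
  λ { (inj₁ eq) → i≢i′ eq ; (inj₂ (inj₁ eq)) → i≢1+i′ eq ; (inj₂ (inj₂ (eq , _))) → i≢0 eq }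
... | yes refl with i′ ≟ K
...   | no i′≢K = 0 , z≤n , inj₁ refl , λ { (inj₁ eq) → i≢i′ eq ; (inj₂ (inj₂ (_ , eq))) → i′≢K eq }
...   | yes refl = 1 , <⇒≤ 2≤K , inj₂ (inj₁ refl) ,
  λ { (inj₁ refl) → <-irrefl refl 2≤K ; (inj₂ (inj₁ refl)) → i≢i′ refl }

module _ (G : Graph n) {K : ℕ} (2≤K : 2 ≤ K) (y : ℕ → Fin n) where

  module _ (distinct : ∀ {i j} → i < j → j ≤ K → y i ≢ y j)
           (next : ∀ {i} → i < K → adj G (y i) (y (suc i)) ≡ true)
           (closing : adj G (y 0) (y K) ≡ true)
           (chordless : ∀ p g → p + g ≤ K → 2 ≤ g → g < K → adj G (y p) (y (p + g)) ≢ true) where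

    induced-cycle : Induced (Cyc (suc K)) G
    induced-cycle = f , (λ {i} {j} → f-inj i j) , λ i j → bool-ext (to i j) (from i j)
      where
      f : Fin (suc K) → Fin n
      f i = y (toℕ i)
      bound : (i : Fin (suc K)) → toℕ i ≤ K
      bound i = Fin.toℕ≤pred[n] i
      f-inj : ∀ i j → f i ≡ f j → i ≡ j
      f-inj i j eq with <-cmp (toℕ i) (toℕ j)
      ... | tri< i<j _ _ = ⊥-elim (distinct i<j (bound j) eq)
      ... | tri≈ _ i≡j _ = Fin.toℕ-injective i≡j
      ... | tri> _ _ j<i = ⊥-elim (distinct j<i (bound i) (sym eq))
      to< : ∀ a b → a < b → b ≤ K → adj G (y a) (y b) ≡ true → cycAdjℕ (suc K) a b ≡ true
      to< a b a<b b≤K ab with b ∸ a in g≡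
      ... | 0 = ⊥-elim (<⇒≱ a<b (m∸n≡0⇒m≤n g≡))
      ... | 1 = subst (λ b → cycAdjℕ (suc K) a b ≡ true)
                  (trans (trans (+-comm 1 a) (cong (a +_) (sym g≡))) (m+[n∸m]≡n (<⇒≤ a<b))) (cycAdj-next (suc K) a)
      ... | suc (suc g) with m≤n⇒m<n∨m≡n (≤-trans (≤-reflexive (sym g≡)) (≤-trans (m∸n≤m b a) b≤K))
      ...   | inj₁ g<K = ⊥-elim (chordless a (2 + g) (subst (_≤ K) (sym b≡) b≤K) (s≤s (s≤s z≤n)) g<K
                           (subst (λ b → adj G (y a) (y b) ≡ true) (sym b≡) ab))
        where
        b≡ : a + (2 + g) ≡ b
        b≡ = trans (cong (a +_) (sym g≡)) (m+[n∸m]≡n (<⇒≤ a<b))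
      -- Indices `K` apart can only be 0 and `K`: this is the closing edge.
      ...   | inj₂ refl with n≤0⇒n≡0 (+-cancelʳ-≤ K a 0 (≤-trans (≤-reflexive (trans (cong (a +_) (sym g≡)) (m+[n∸m]≡n (<⇒≤ a<b)))) b≤K))
      ...     | refl = subst (λ b → cycAdjℕ (suc K) 0 b ≡ true) (sym g≡) (cycAdj-closing K)
      to : ∀ i j → adj G (f i) (f j) ≡ true → Cyc (suc K) i j ≡ true
      to i j ij with <-cmp (toℕ i) (toℕ j)
      ... | tri< i<j _ _ = to< (toℕ i) (toℕ j) i<j (bound j) ij
      ... | tri≈ _ i≡j _ = ⊥-elim (adj⇒≢ G ij (cong y i≡j))
      ... | tri> _ _ j<i = cycAdj-sym (suc K) (toℕ j) (toℕ i) (to< (toℕ j) (toℕ i) j<i (bound i) (adj-flip G ij))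
      from′ : ∀ a b → a ≤ K → b ≤ K → cycAdjℕ (suc K) a b ≡ true → adj G (y a) (y b) ≡ true
      from′ a b a≤K b≤K eq with cycAdj-cases {suc K} {a} {b} eq
      ... | inj₁ refl = next b≤K
      ... | inj₂ (inj₁ refl) = adj-flip G (next a≤K)
      ... | inj₂ (inj₂ (inj₁ (refl , refl))) = closing
      ... | inj₂ (inj₂ (inj₂ (refl , refl))) = adj-flip G closing
      from : ∀ i j → Cyc (suc K) i j ≡ true → adj G (f i) (f j) ≡ true
      from i j = from′ (toℕ i) (toℕ j) (bound i) (bound j)

  module _ (chordal : Chordal G)
           (complete : ∀ {i j} → i ≤ K → j ≤ K → i ≢ j → adj G (y i) (y j) ≡ true)
           (D : ℕ → Subset n) (D-max : ∀ {i} → i ≤ K → MaximalClique G (D i))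
           (D⁺ : ∀ {i j} → i ≤ K → j ≤ K → Incident K i j → y j ∈ D i)
           (D⁻ : ∀ {i j} → i ≤ K → j ≤ K → y j ∈ D i → Incident K i j) where

    Missed : ℕ → Fin n → Set
    Missed i v = ∃ λ j → j < suc K × v ≡ y j × y j ∉ D i

    missed : ∀ {i} → i ≤ K → ∃ λ j → j ≤ K × y j ∉ D i
    missed {i} i≤K =
      let i′ , i′≤K , i′≢i = other i
          j , j≤K , _ , ¬ij = separating 2≤K i′≤K i≤K i′≢i
      in j , j≤K , λ yj∈D → ¬ij (D⁻ i≤K j≤K yj∈D)
      where
      other : ∀ i → ∃ λ i′ → i′ ≤ K × i′ ≢ i
      other zero    = 1 , <⇒≤ 2≤K , λ ()
      other (suc i) = 0 , z≤n , λ ()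

    -- The sun vertex w_i over the clique formed by the cycle vertices u_j.
    record Ray (i : ℕ) : Set where
      field
        w     : Fin n
        w≢y   : ∀ {j} → j ≤ K → w ≢ y j
        near  : ∀ {j} → j ≤ K → Incident K i j → adj G w (y j) ≡ true
        apart : ∀ {j} → j ≤ K → ¬ Incident K i j → adj G w (y j) ≡ false

    -- The cycle vertices outside `D i` form a clique disjoint from `D i`, so one vertex of `D i` is
    -- joined to none of them.
    ray : ∀ {i} → i ≤ K → Ray i
    ray {i} i≤K with common-non-neighbour G chordal (D-max i≤K) {Missed i}
                       (λ v → anyUpTo? (λ j → (v Fin.≟ y j) ×-dec ¬? (y j ∈? D i)) (suc K))
                       (let j , j≤K , y∉ = missed i≤K in y j , j , s≤s j≤K , refl , y∉)
                       (λ { (j , _ , refl , y∉) → y∉ })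
                       (λ { (j , s≤s j≤K , refl , _) (j′ , s≤s j′≤K , refl , _) y≢ → complete j≤K j′≤K λ { refl → y≢ refl } })
    ... | w , w∈D , w-apart = record
      { w = w
      ; w≢y = w≢y
      ; near = λ j≤K ij → proj₁ (D-max i≤K) w _ w∈D (D⁺ i≤K j≤K ij) (w≢y j≤K)
      ; apart = λ j≤K ¬ij → w-apart (_ , s≤s j≤K , refl , λ y∈ → ¬ij (D⁻ i≤K j≤K y∈)) }
      where
      w≢y : ∀ {j} → j ≤ K → w ≢ y j
      w≢y {j} j≤K w≡y with missed i≤K
      ... | t , t≤K , yt∉D = false≢true (w-apart (t , s≤s t≤K , refl , yt∉D))
        (subst (λ v → adj G v (y t) ≡ true) (sym w≡y)
          (complete j≤K t≤K λ { refl → yt∉D (subst (_∈ D i) w≡y w∈D) }))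

    -- Two adjacent rays and a private neighbour of each would form an induced square.
    rays-nonadjacent : ∀ {i i′} → i ≤ K → i′ ≤ K → i ≢ i′ → (r : Ray i) (r′ : Ray i′) →
                       adj G (Ray.w r) (Ray.w r′) ≡ true → ⊥
    rays-nonadjacent i≤K i′≤K i≢i′ r r′ ww′ =
      let j , j≤K , ij , ¬i′j = separating 2≤K i≤K i′≤K i≢i′
          j′ , j′≤K , i′j′ , ¬ij′ = separating 2≤K i′≤K i≤K λ i′≡i → i≢i′ (sym i′≡i)
      in no-square G chordal (Ray.w≢y r j′≤K) (Ray.w≢y r′ j≤K)
           ww′ (Ray.near r′ j′≤K i′j′) (complete j′≤K j≤K λ j′≡j → ¬i′j (subst (Incident K _) j′≡j i′j′))
           (adj-flip G (Ray.near r j≤K ij)) (Ray.apart r j′≤K ¬ij′) (Ray.apart r′ j≤K ¬i′j)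

    rays-distinct : ∀ {i i′} → i ≤ K → i′ ≤ K → i ≢ i′ → (r : Ray i) (r′ : Ray i′) → Ray.w r ≢ Ray.w r′
    rays-distinct i≤K i′≤K i≢i′ r r′ w≡w′ =
      let j , j≤K , ij , ¬i′j = separating 2≤K i≤K i′≤K i≢i′
      in false≢true (Ray.apart r′ j≤K ¬i′j) (subst (λ v → adj G v (y j) ≡ true) w≡w′ (Ray.near r j≤K ij))

    induced-sun : Induced (Sun (suc K)) G
    induced-sun = (λ i → h (splitAt (suc K) i)) , inj , λ i j → h-adj (splitAt (suc K) i) (splitAt (suc K) j)
      where
      bound : (i : Fin (suc K)) → toℕ i ≤ K
      bound i = Fin.toℕ≤pred[n] i
      r : (i : Fin (suc K)) → Ray (toℕ i)
      r i = ray (bound i)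
      apart : ∀ {i j : Fin (suc K)} → i ≢ j → toℕ i ≢ toℕ j
      apart i≢j eq = i≢j (Fin.toℕ-injective eq)
      h : Fin (suc K) ⊎ Fin (suc K) → Fin n
      h (inj₁ i) = y (toℕ i)
      h (inj₂ i) = Ray.w (r i)
      ray-adj : ∀ i j → adj G (Ray.w (r i)) (y (toℕ j)) ≡ wuAdj (suc K) i j
      ray-adj i j = bool-ext
        (λ wy → ¬-not λ ¬ij → false≢true (Ray.apart (r i) (bound j) (λ ij → false≢true ¬ij (wuAdj⁺ i j ij))) wy)
        (λ ij → Ray.near (r i) (bound j) (wuAdj⁻ i j ij))
      h-adj : ∀ s t → adj G (h s) (h t) ≡ sunAdj (suc K) s t
      h-adj (inj₁ i) (inj₁ j) with i Fin.≟ j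
      ... | yes refl = adj-irr G (y (toℕ i))
      ... | no i≢j = complete (bound i) (bound j) (apart i≢j)
      h-adj (inj₁ i) (inj₂ j) = adj-flip G (ray-adj j i)
      h-adj (inj₂ i) (inj₁ j) = ray-adj i j
      h-adj (inj₂ i) (inj₂ j) with i Fin.≟ j
      ... | yes refl = adj-irr G (Ray.w (r i))
      ... | no i≢j = ¬-not (rays-nonadjacent (bound i) (bound j) (apart i≢j) (r i) (r j))
      h-inj : ∀ s t → h s ≡ h t → s ≡ t
      h-inj (inj₁ i) (inj₁ j) eq with i Fin.≟ j
      ... | yes refl = refl
      ... | no i≢j = ⊥-elim (adj⇒≢ G (complete (bound i) (bound j) (apart i≢j)) eq)
      h-inj (inj₁ i) (inj₂ j) eq = ⊥-elim (Ray.w≢y (r j) (bound i) (sym eq))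
      h-inj (inj₂ i) (inj₁ j) eq = ⊥-elim (Ray.w≢y (r i) (bound j) eq)
      h-inj (inj₂ i) (inj₂ j) eq with i Fin.≟ j
      ... | yes refl = refl
      ... | no i≢j = ⊥-elim (rays-distinct (bound i) (bound j) (apart i≢j) (r i) (r j) eq)
      inj : ∀ {i j} → h (splitAt (suc K) i) ≡ h (splitAt (suc K) j) → i ≡ j
      inj {i} {j} eq = trans (sym (Fin.join-splitAt (suc K) (suc K) i))
        (trans (cong (join (suc K) (suc K)) (h-inj (splitAt (suc K) i) (splitAt (suc K) j) eq)) (Fin.join-splitAt (suc K) (suc K) j))

-- Strong induction on `K` makes the cycle at hand a shortest one; its chords decide between a sun
-- and an induced cycle.
maximal-cliques-totally-balanced : {G : Graph n} → StronglyChordal G → TotallyBalanced (MaximalClique G)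
maximal-cliques-totally-balanced {n} {G} (chordal , sun-free) = <-rec _ body
  where
  body : ∀ K → (∀ {K′} → K′ < K → 2 ≤ K′ → ¬ SpecialCycle (MaximalClique G) K′) →
         2 ≤ K → ¬ SpecialCycle (MaximalClique G) K
  body K minimal 2≤K sc = by-chord (anyUpTo? (λ p → anyUpTo? (chord? p) K) K)
    where
    open SpecialCycle sc
    open MinimalCycle 2≤K sc minimal

    Chord : ℕ → ℕ → Set
    Chord p g = p + g ≤ K × 2 ≤ g × adj G (y p) (y (p + g)) ≡ true

    chord? : ∀ p → Decidable (Chord p)
    chord? p g = (p + g ≤? K) ×-dec (2 ≤? g) ×-dec (adj G (y p) (y (p + g)) Bool.≟ true)

    next : ∀ {i} → i < K → adj G (y i) (y (suc i)) ≡ true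
    next {i} i<K = proj₁ (c∈𝓗 i<K) _ _ (left i<K) (right i<K) (y-distinct (n<1+n i) i<K)

    closing : adj G (y 0) (y K) ≡ true
    closing = proj₁ e∈𝓗 _ _ first last (y-distinct (≤-trans (s≤s z≤n) 2≤K) ≤-refl)

    -- Undoes the cut: `e` becomes the hyperedge of index `K`, as `Incident` expects.
    D : ℕ → Subset n
    D i = if does (i <? K) then c i else e

    D-inner : ∀ {i} → i < K → D i ≡ c i
    D-inner {i} i<K rewrite dec-true (i <? K) i<K = refl

    D-closing : D K ≡ e
    D-closing rewrite dec-false (K <? K) (<-irrefl refl) = refl

    D-max : ∀ {i} → i ≤ K → MaximalClique G (D i)
    D-max i≤K with m≤n⇒m<n∨m≡n i≤K
    ... | inj₁ i<K = subst (MaximalClique G) (sym (D-inner i<K)) (c∈𝓗 i<K)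
    ... | inj₂ refl = subst (MaximalClique G) (sym D-closing) e∈𝓗

    D⁺ : ∀ {i j} → i ≤ K → j ≤ K → Incident K i j → y j ∈ D i
    D⁺ {i} {j} i≤K j≤K ij with m≤n⇒m<n∨m≡n i≤K
    ... | inj₁ i<K = subst (y j ∈_) (sym (D-inner i<K)) (inner ij)
      where
      inner : Incident K i j → y j ∈ c i
      inner (inj₁ refl) = left i<K
      inner (inj₂ (inj₁ refl)) = right i<K
      inner (inj₂ (inj₂ (_ , refl))) = ⊥-elim (<-irrefl refl i<K)
    ... | inj₂ refl = subst (y j ∈_) (sym D-closing) (outer ij)
      where
      outer : Incident K K j → y j ∈ e
      outer (inj₁ refl) = last
      outer (inj₂ (inj₁ refl)) = ⊥-elim (1+n≰n j≤K)
      outer (inj₂ (inj₂ (refl , _))) = first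

    D⁻ : ∀ {i j} → i ≤ K → j ≤ K → y j ∈ D i → Incident K i j
    D⁻ {i} {j} i≤K j≤K y∈ with m≤n⇒m<n∨m≡n i≤K
    ... | inj₁ i<K with only i<K j≤K (subst (y j ∈_) (D-inner i<K) y∈)
    ...   | inj₁ j≡i = inj₁ j≡i
    ...   | inj₂ j≡1+i = inj₂ (inj₁ j≡1+i)
    D⁻ {i} {j} i≤K j≤K y∈ | inj₂ refl with ends j≤K (subst (y j ∈_) D-closing y∈)
    ...   | inj₁ j≡0 = inj₂ (inj₂ (j≡0 , refl))
    ...   | inj₂ j≡K = inj₁ j≡K

    sun : (∀ {i j} → i ≤ K → j ≤ K → i ≢ j → adj G (y i) (y j) ≡ true) → ⊥
    sun complete = absurd 2≤K (induced-sun G 2≤K y chordal complete D D-max D⁺ D⁻)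
      where
      absurd : ∀ {K} → 2 ≤ K → Induced (Sun (suc K)) G → ⊥
      absurd {suc (suc m)} (s≤s (s≤s z≤n)) = sun-free m

    cycle : (∀ p g → p + g ≤ K → 2 ≤ g → g < K → adj G (y p) (y (p + g)) ≢ true) → 3 ≤ K → ⊥
    cycle chordless 3≤K = absurd 3≤K (induced-cycle G 2≤K y y-distinct next closing chordless)
      where
      absurd : ∀ {K} → 3 ≤ K → Induced (Cyc (suc K)) G → ⊥
      absurd {suc (suc (suc m))} (s≤s (s≤s (s≤s z≤n))) = chordal m

    triangle : K ≡ 2 → ∀ {i j} → i < j → j ≤ 2 → adj G (y i) (y j) ≡ true
    triangle refl {0} {1} _ _ = next (s≤s z≤n)
    triangle refl {0} {2} _ _ = closing
    triangle refl {1} {2} _ _ = next (s≤s (s≤s z≤n))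
    triangle _ {suc i} {1} (s≤s ()) _
    triangle _ {suc (suc i)} {2} (s≤s (s≤s ())) _
    triangle _ {_} {suc (suc (suc j))} _ (s≤s (s≤s ()))

    symmetric : (∀ {i j} → i < j → j ≤ K → adj G (y i) (y j) ≡ true) →
                ∀ {i j} → i ≤ K → j ≤ K → i ≢ j → adj G (y i) (y j) ≡ true
    symmetric ordered {i} {j} i≤K j≤K i≢j with <-cmp i j
    ... | tri< i<j _ _ = ordered i<j j≤K
    ... | tri≈ _ i≡j _ = ⊥-elim (i≢j i≡j)
    ... | tri> _ _ j<i = adj-flip G (ordered j<i i≤K)

    by-chord : Dec (∃ λ p → p < K × ∃ λ g → g < K × Chord p g) → ⊥
    by-chord (yes (p , _ , g , g<K , p+g≤K , 2≤g , pq)) =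
      -- A maximal clique over one chord contains all cycle vertices by minimality, so they are
      -- pairwise adjacent.
      let C , C-max , yp∈C , yq∈C = maximal-clique-cover G (y p) (y (p + g)) (inj₂ pq)
          y∈C = chord⇒all C-max p g p+g≤K 2≤g g<K yp∈C yq∈C
      in sun (symmetric λ i<j j≤K → proj₁ C-max _ _ (y∈C _ (<⇒≤ (≤-trans i<j j≤K))) (y∈C _ j≤K) (y-distinct i<j j≤K))
    by-chord (no ¬chord) with m≤n⇒m<n∨m≡n 2≤K
    -- Three vertices in a cycle have no chord but are already complete, which gives a 3-sun.
    ... | inj₂ 2≡K = sun (symmetric λ i<j j≤K → triangle (sym 2≡K) i<j (subst (_ ≤_) (sym 2≡K) j≤K))
    ... | inj₁ 3≤K = cycle (λ p g p+g≤K 2≤g g<K pq →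
                        ¬chord (p , p<K p+g≤K 2≤g , g , g<K , p+g≤K , 2≤g , pq)) 3≤K
      where
      p<K : ∀ {p g} → p + g ≤ K → 2 ≤ g → p < K
      p<K {p} p+g≤K 2≤g = ≤-trans (m<m+n p (<⇒≤ 2≤g)) p+g≤K

theorem5p11 : ∀ (n : ℕ) (G : Graph n) → StronglyChordal G → HasMATLabeling G
theorem5p11 n G sc =
  MAT-labeling (maximalClique? G) (maximal-cliques-totally-balanced {G = G} sc) proj₁ (maximal-clique-cover G)
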